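{- Every GaTEx graph is a permutation graph.
   Context: All graphs are finite, simple and undirected. A galled-tree on a finite nonempty set $X$ is a directed acyclic graph $N=(V,E)$ such that either $V=X=\{x\}$ and $E=\emptyset$, or: (N1) there is a unique root with indegree 0 and outdegree at least 2; (N2) $x\in X$ iff $x$ has outdegree 0 and indegree 1; (N3) every non-root $v\in V\setminus X$ has either indegree 1 and outdegree at least 2, or indegree 2 and outdegree at least 1 (hybrid-vertex); (N4) each biconnected component $C$ of $N$ contains at most one hybrid-vertex whose two in-neighbours both belong to $C$. For $x,y\in X$, $\mathrm{lca}_N(x,y)$ is the (unique) minimal common ancestor of $x,y$. A labeled galled-tree $(N,t)$ has $t:V\to\{0,1,\odot\}$ with $t(x)=\odot$ iff $x\in X$; it explains the graph on $X$ where $\{x,y\}$ is an edge iff $t(\mathrm{lca}_N(x,y))=1$. A graph is GaTEx if it is isomorphic to a graph explained by some labeled galled-tree. A graph $G=(V,E)$ with $|V|=n$ is a permutation graph if there are a bijection $\ell:V\to\{1,\dots,n\}$ and a permutation $\pi$ of $\{1,\dots,n\}$ such that for distinct $u,v\in V$, $\{u,v\}\in E$ iff $\ell(u)>\ell(v)$ and $\pi^{ -1}(\ell(u))<\pi^{ -1}(\ell(v))$, or vice versa with $u,v$ interchanged. -}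

module Defs where

open import Level using (Level; _⊔_) renaming (suc to lsuc; zero to lzero)
open import Data.Nat using (ℕ; zero; suc; _+_; _≥_)
open import Data.Bool using (Bool; true; false; if_then_else_)
open import Data.Fin using (Fin) renaming (_<_ to _<ᶠ_)
open import Data.Fin.Permutation using (Permutation′; _⟨$⟩ʳ_; _⟨$⟩ˡ_)
open import Data.List using (List; map; allFin)
open import Data.Nat.ListAction using (sum)
open import Data.Product using (Σ; _×_; _,_; ∃)
open import Data.Sum using (_⊎_)
open import Data.Empty using (⊥)
open import Relation.Nullary using (¬_)
open import Relation.Binary.PropositionalEquality using (_≡_; _≢_)
open import Function.Bundles using (_⇔_)

record Graph (n : ℕ) : Set₁ where
  field
    Adj    : Fin n → Fin n → Set
    sym    : ∀ {u v} → Adj u v → Adj v u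
    irrefl : ∀ {u} → ¬ Adj u u
open Graph public

-- Permutation graphs
-- ℓ : V → {1..n} (here Fin n, 0-based), π a permutation of Fin n.
-- π⁻¹ is  π ⟨$⟩ˡ_ .

IsPermutationGraph : ∀ {n} → Graph n → Set
IsPermutationGraph {n} G =
  Σ (Permutation′ n) λ ℓ → Σ (Permutation′ n) λ π →
    ∀ (u v : Fin n) → u ≢ v →
      Adj G u v ⇔
        (  ((ℓ ⟨$⟩ʳ v) <ᶠ (ℓ ⟨$⟩ʳ u) × (π ⟨$⟩ˡ (ℓ ⟨$⟩ʳ u)) <ᶠ (π ⟨$⟩ˡ (ℓ ⟨$⟩ʳ v)))
         ⊎ ((ℓ ⟨$⟩ʳ u) <ᶠ (ℓ ⟨$⟩ʳ v) × (π ⟨$⟩ˡ (ℓ ⟨$⟩ʳ v)) <ᶠ (π ⟨$⟩ˡ (ℓ ⟨$⟩ʳ u))))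

Arcs : ℕ → Set
Arcs m = Fin m → Fin m → Bool

countTrue : ∀ {m} → (Fin m → Bool) → ℕ
countTrue {m} f = sum (map (λ i → if f i then 1 else 0) (allFin m))

indeg : ∀ {m} → Arcs m → Fin m → ℕ
indeg A v = countTrue (λ u → A u v)

outdeg : ∀ {m} → Arcs m → Fin m → ℕ
outdeg A v = countTrue (λ w → A v w)

data Path {m} (A : Arcs m) : Fin m → Fin m → Set where
  here : ∀ {u} → Path A u u
  step : ∀ {u w v} → A u w ≡ true → Path A w v → Path A u v

Acyclic : ∀ {m} → Arcs m → Set
Acyclic A = ∀ u v → A u v ≡ true → ¬ Path A v u

UAdj : ∀ {m} → Arcs m → Fin m → Fin m → Set
UAdj A u v = (A u v ≡ true) ⊎ (A v u ≡ true)

VSet : ℕ → Set₁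
VSet m = Fin m → Set

data WalkIn {m} (A : Arcs m) (S : VSet m) : Fin m → Fin m → Set where
  nil  : ∀ {u} → WalkIn A S u u
  cons : ∀ {u w v} → UAdj A u w → S w → WalkIn A S w v → WalkIn A S u v

ConnectedIn : ∀ {m} → Arcs m → VSet m → Set
ConnectedIn A S = ∀ u v → S u → S v → WalkIn A S u v

Biconnected : ∀ {m} → Arcs m → VSet m → Set
Biconnected A S =
  (∃ λ v → S v) × ConnectedIn A S ×
  (∀ v → S v → ConnectedIn A (λ u → S u × u ≢ v))

BiconnectedComponent : ∀ {m} → Arcs m → VSet m → Set₁
BiconnectedComponent {m} A C =
  Biconnected A C ×
  (∀ (C' : VSet m) → Biconnected A C' → (∀ v → C v → C' v) → ∀ v → C' v → C v)

IsGalledTree : ∀ {m} → Arcs m → VSet m → Set₁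
IsGalledTree {m} A X =
    ((m ≡ 1) × (∀ v → X v) × (∀ u v → A u v ≡ false))
  ⊎ ( Acyclic A
    × (∀ v → A v v ≡ false)
    × Σ (Fin m) (λ r →
        (indeg A r ≡ 0) × (outdeg A r ≥ 2) × (∀ v → indeg A v ≡ 0 → v ≡ r)
      × (∀ v → v ≢ r → ¬ X v →
           ((indeg A v ≡ 1) × (outdeg A v ≥ 2))
         ⊎ ((indeg A v ≡ 2) × (outdeg A v ≥ 1))))
    × (∀ x → X x ⇔ ((outdeg A x ≡ 0) × (indeg A x ≡ 1)))
    × (∀ (C : VSet m) → BiconnectedComponent A C →
         ∀ h h' →
           C h → indeg A h ≡ 2 → (∀ u → A u h ≡ true → C u) →
           C h' → indeg A h' ≡ 2 → (∀ u → A u h' ≡ true → C u) →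
           h ≡ h'))

data Label : Set where
  zeroL oneL odot : Label

IsLCA : ∀ {m} → Arcs m → Fin m → Fin m → Fin m → Set
IsLCA A x y w =
  Path A w x × Path A w y ×
  (∀ w' → Path A w' x → Path A w' y → Path A w w' → w' ≡ w)

-- G is GaTEx: G is isomorphic (via φ onto the leaf set X = image φ) to the
-- graph explained by a labeled galled-tree (N, t) on X.
IsGaTEx : ∀ {n} → Graph n → Set₁
IsGaTEx {n} G =
  Σ ℕ λ m → Σ (Arcs m) λ A → Σ (Fin m → Label) λ t → Σ (Fin n → Fin m) λ φ →
    let X : VSet m
        X v = ∃ λ i → φ i ≡ v
    in
    (∀ i j → φ i ≡ φ j → i ≡ j)
  × IsGalledTree A X
  × (∀ v → (t v ≡ odot) ⇔ X v)
  × (∀ i j → i ≢ j →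
       Adj G i j ⇔ (∃ λ w → IsLCA A (φ i) (φ j) w × t w ≡ oneL))

{-# OPTIONS --safe #-}
-- A realizer is a pair of linear orders on the leaves such that adjacent leaves
-- are exactly those on which the orders disagree.  Realizers of the leaf sets
-- L(u) are built from the leaves upwards.  Children of v whose descendants
-- overlap come in pairs, the two sides of a cycle with top v and hybrid x; any
-- two other children have v as lca of their leaves, so their realizers are
-- concatenated, reversing the second order when t(v) = 1.  For a cycle, the
-- realizer of a vertex on a side can be made to extend a given one of L(x) with
-- L(x) at a chosen end of either order.  Writing A and B for the leaf sets of
-- the two sides, the cycle is realized by the orders (A \ L(x)), B and
-- A, (B \ L(x)), the blocks of the second one being exchanged when t(v) = 1.
module Submission where

open import Defs hiding (sym)
open import Data.Nat using (ℕ; zero; suc; _+_; _*_; _∸_; _≤_; _<_; _<?_; z≤n; s≤s)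
open import Data.Nat.Properties hiding (_≟_; _<?_)
open import Data.Nat.ListAction using (sum)
open import Data.Bool using (Bool; true; false; if_then_else_; not)
import Data.Bool.Properties as Boolₚ
open import Data.Fin as Fin using (Fin; toℕ; fromℕ<)
import Data.Fin.Properties as Finₚ
open import Data.Fin.Properties using (_≟_; any?)
import Data.Fin.Induction as FinInd
open import Data.Fin.Permutation using (Permutation′; permutation; _∘ₚ_; _⟨$⟩ʳ_; _⟨$⟩ˡ_; inverseˡ)
  renaming (flip to flipₚ)
open import Data.Fin.Subset using (Subset; ∣_∣; _∈_)
open import Data.Fin.Subset.Properties using (p⊂q⇒∣p∣<∣q∣; x∈p⇒∣p-x∣<∣p∣; x∈p∧x≢y⇒x∈p-y; ∣⊤∣≡n; ∈⊤)
import Data.List.Properties as Listₚ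
open import Data.Maybe as Maybe using (Maybe; just; nothing; fromMaybe)
open import Data.Product using (Σ; ∃; _×_; _,_; proj₁; proj₂)
open import Data.Sum as Sum using (_⊎_; inj₁; inj₂)
open import Data.Unit using (⊤)
open import Data.Vec using (tabulate)
import Data.Vec.Properties as Vecₚ
open import Function using (_∘_; id; flip; Injective)
open import Function.Bundles using (_⇔_; mk⇔; Equivalence)
open import Induction.WellFounded using (WellFounded; Acc; acc)
open import Relation.Binary using (IsStrictPartialOrder; tri<; tri≈; tri>)
open import Relation.Binary.PropositionalEquality hiding ([_])
open import Relation.Nullary using (¬_; Dec; yes; no; contradiction)
open import Relation.Nullary.Decidable
  using (does; dec-true; does-⇔; map′; _×-dec_; _⊎-dec_; ¬?; decidable-stable; ¬¬-excluded-middle)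

-- Counting

countTrue-suc : ∀ {m} (f : Fin (suc m) → Bool) →
                countTrue f ≡ (if f Fin.zero then 1 else 0) + countTrue (f ∘ Fin.suc)
countTrue-suc f = cong (λ l → (if f Fin.zero then 1 else 0) + sum l)
  (trans (Listₚ.map-tabulate Fin.suc (λ i → if f i then 1 else 0))
         (sym (Listₚ.map-tabulate id (λ i → if f (Fin.suc i) then 1 else 0))))

countTrue≡∣tabulate∣ : ∀ {m} (f : Fin m → Bool) → countTrue f ≡ ∣ tabulate f ∣
countTrue≡∣tabulate∣ {zero}  f = refl
countTrue≡∣tabulate∣ {suc m} f with f Fin.zero | countTrue-suc f
... | true  | eq = trans eq (cong suc (countTrue≡∣tabulate∣ (f ∘ Fin.suc)))
... | false | eq = trans eq (countTrue≡∣tabulate∣ (f ∘ Fin.suc))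

countTrue-none : ∀ {m} (f : Fin m → Bool) → (∀ i → f i ≡ false) → countTrue f ≡ 0
countTrue-none {zero}  f none = refl
countTrue-none {suc m} f none = trans (countTrue-suc f)
  (cong₂ (λ b k → (if b then 1 else 0) + k) (none Fin.zero) (countTrue-none (f ∘ Fin.suc) (none ∘ Fin.suc)))

∈-tabulate : ∀ {m} (f : Fin m → Bool) {i} → f i ≡ true → i ∈ tabulate f
∈-tabulate f {i} eq = Vecₚ.lookup⇒[]= i (tabulate f) (trans (Vecₚ.lookup∘tabulate f i) eq)

∈-tabulate⁻ : ∀ {m} (f : Fin m → Bool) {i} → i ∈ tabulate f → f i ≡ true
∈-tabulate⁻ f {i} i∈ = trans (sym (Vecₚ.lookup∘tabulate f i)) (Vecₚ.[]=⇒lookup i∈)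

module _ {m} (f : Fin m → Bool) where

  countTrue≥1 : ∀ {a} → f a ≡ true → 1 ≤ countTrue f
  countTrue≥1 fa rewrite countTrue≡∣tabulate∣ f =
    ≤-trans (s≤s z≤n) (x∈p⇒∣p-x∣<∣p∣ (∈-tabulate f fa))

  countTrue≥2 : ∀ {a b} → f a ≡ true → f b ≡ true → a ≢ b → 2 ≤ countTrue f
  countTrue≥2 fa fb a≢b rewrite countTrue≡∣tabulate∣ f =
    ≤-trans (s≤s (≤-trans (s≤s z≤n)
      (x∈p⇒∣p-x∣<∣p∣ (x∈p∧x≢y⇒x∈p-y (∈-tabulate f fb) (a≢b ∘ sym)))))
      (x∈p⇒∣p-x∣<∣p∣ (∈-tabulate f fa))

  countTrue≥3 : ∀ {a b c} → f a ≡ true → f b ≡ true → f c ≡ true →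
                a ≢ b → a ≢ c → b ≢ c → 3 ≤ countTrue f
  countTrue≥3 fa fb fc a≢b a≢c b≢c rewrite countTrue≡∣tabulate∣ f =
    ≤-trans (s≤s (≤-trans (s≤s (≤-trans (s≤s z≤n)
      (x∈p⇒∣p-x∣<∣p∣ (x∈p∧x≢y⇒x∈p-y (x∈p∧x≢y⇒x∈p-y (∈-tabulate f fc) (a≢c ∘ sym)) (b≢c ∘ sym)))))
      (x∈p⇒∣p-x∣<∣p∣ (x∈p∧x≢y⇒x∈p-y (∈-tabulate f fb) (a≢b ∘ sym)))))
      (x∈p⇒∣p-x∣<∣p∣ (∈-tabulate f fa))

does-true : ∀ {P : Set} (P? : Dec P) → does P? ≡ true → P
does-true (yes p) _ = p

-- Permutations from injective keys

-- A missed value `y` would extend `f` to an injection from `Fin (suc n)` into `Fin n`.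
injective⇒surjective : ∀ {n} {f : Fin n → Fin n} → Injective _≡_ _≡_ f → ∀ y → ∃ λ x → f x ≡ y
injective⇒surjective {n} {f} inj y with Finₚ.any? (λ x → f x Finₚ.≟ y)
... | yes hit = hit
... | no miss = contradiction (Finₚ.injective⇒≤ g-inj) 1+n≰n
  where
  g : Fin (suc n) → Fin n
  g Fin.zero    = y
  g (Fin.suc i) = f i

  g-inj : Injective _≡_ _≡_ g
  g-inj {Fin.zero}  {Fin.zero}  eq = refl
  g-inj {Fin.zero}  {Fin.suc j} eq = contradiction (j , sym eq) miss
  g-inj {Fin.suc i} {Fin.zero}  eq = contradiction (i , eq) miss
  g-inj {Fin.suc i} {Fin.suc j} eq = cong Fin.suc (inj eq)

module _ {n} (f : Fin n → ℕ) (f-inj : ∀ {i j} → f i ≡ f j → i ≡ j) where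

  private
    smaller : Fin n → Subset n
    smaller i = tabulate (λ j → does (f j <? f i))

    smaller⁺ : ∀ {i j} → f j < f i → j ∈ smaller i
    smaller⁺ {i} {j} lt = ∈-tabulate _ (dec-true (f j <? f i) lt)

    smaller⁻ : ∀ {i j} → j ∈ smaller i → f j < f i
    smaller⁻ {i} {j} j∈ = does-true (f j <? f i) (∈-tabulate⁻ (λ j → does (f j <? f i)) j∈)

    rank : Fin n → Fin n
    -- The number of smaller keys is below `n` because `i` itself is never counted.
    rank i = fromℕ< {∣ smaller i ∣} (subst (∣ smaller i ∣ <_) (∣⊤∣≡n n)
      (p⊂q⇒∣p∣<∣q∣ ((λ _ → ∈⊤) , i , ∈⊤ , λ i∈ → <-irrefl refl (smaller⁻ i∈))))

    rank-mono : ∀ {i j} → f i < f j → rank i Fin.< rank j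
    rank-mono {i} {j} lt = subst₂ _<_ (sym (Finₚ.toℕ-fromℕ< _)) (sym (Finₚ.toℕ-fromℕ< _))
      (p⊂q⇒∣p∣<∣q∣ ((λ k∈ → smaller⁺ (<-trans (smaller⁻ k∈) lt)) , i , smaller⁺ lt
                   , λ i∈ → <-irrefl refl (smaller⁻ i∈)))

    rank-inj : Injective _≡_ _≡_ rank
    rank-inj {i} {j} eq with <-cmp (f i) (f j)
    ... | tri< lt _ _ = contradiction (cong toℕ eq) (<⇒≢ (rank-mono lt))
    ... | tri≈ _ fi≡fj _ = f-inj fi≡fj
    ... | tri> _ _ gt = contradiction (cong toℕ (sym eq)) (<⇒≢ (rank-mono gt))

    unrank : Fin n → Fin n
    unrank y = proj₁ (injective⇒surjective rank-inj y)

    rank-unrank : ∀ y → rank (unrank y) ≡ y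
    rank-unrank y = proj₂ (injective⇒surjective rank-inj y)

  sorting : Permutation′ n
  sorting = permutation rank unrank rank-unrank (λ i → rank-inj (rank-unrank (rank i)))

  sorting-mono : ∀ {i j} → f i < f j → (sorting ⟨$⟩ʳ i) Fin.< (sorting ⟨$⟩ʳ j)
  sorting-mono = rank-mono

  sorting-mono⁻ : ∀ {i j} → (sorting ⟨$⟩ʳ i) Fin.< (sorting ⟨$⟩ʳ j) → f i < f j
  sorting-mono⁻ {i} {j} lt with <-cmp (f i) (f j)
  ... | tri< fi<fj _ _ = fi<fj
  ... | tri≈ _ fi≡fj _ rewrite f-inj fi≡fj = contradiction lt (<-irrefl refl)
  ... | tri> _ _ gt = contradiction lt (<⇒≯ (rank-mono gt))

-- Keys are natural numbers constrained on `S` only, so realizers restrict to subsets and blocks can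
-- be concatenated by shifting keys.
record Realizer {n} (Adj : Fin n → Fin n → Set) (S : Fin n → Set) : Set where
  field
    f₁ f₂ : Fin n → ℕ
    f₁-inj : ∀ {i j} → S i → S j → f₁ i ≡ f₁ j → i ≡ j
    f₂-inj : ∀ {i j} → S i → S j → f₂ i ≡ f₂ j → i ≡ j
    adj   : ∀ {i j} → S i → S j → f₁ i < f₁ j → Adj i j ⇔ f₂ j < f₂ i

-- With `ℓ` and `r` the ranks in the two orders, the permutation is `ℓ` after the inverse of `r`.
-- Its inverse then sends `ℓ u` to `r u`, so its inversions are the disagreements of the two orders.
realizer⇒permutationGraph : ∀ {n} (G : Graph n) {S} → (∀ i → S i) → Realizer (Adj G) S → IsPermutationGraph G
realizer⇒permutationGraph {n} G all ρ = ℓ , flipₚ r ∘ₚ ℓ , λ u v u≢v → mk⇔ (to u≢v) from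
  where
  open Realizer ρ
  ℓ r : Permutation′ n
  ℓ = sorting f₁ (λ {i} {j} → f₁-inj (all i) (all j))
  r = sorting f₂ (λ {i} {j} → f₂-inj (all i) (all j))

  ℓ⁺ : ∀ {i j} → f₁ i < f₁ j → (ℓ ⟨$⟩ʳ i) Fin.< (ℓ ⟨$⟩ʳ j)
  ℓ⁺ = sorting-mono f₁ (λ {i} {j} → f₁-inj (all i) (all j))

  ℓ⁻ : ∀ {i j} → (ℓ ⟨$⟩ʳ i) Fin.< (ℓ ⟨$⟩ʳ j) → f₁ i < f₁ j
  ℓ⁻ = sorting-mono⁻ f₁ (λ {i} {j} → f₁-inj (all i) (all j))

  r⁺ : ∀ {i j} → f₂ i < f₂ j → (r ⟨$⟩ʳ (ℓ ⟨$⟩ˡ (ℓ ⟨$⟩ʳ i))) Fin.< (r ⟨$⟩ʳ (ℓ ⟨$⟩ˡ (ℓ ⟨$⟩ʳ j)))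
  r⁺ {i} {j} lt rewrite inverseˡ ℓ {i} | inverseˡ ℓ {j} =
    sorting-mono f₂ (λ {i} {j} → f₂-inj (all i) (all j)) lt

  r⁻ : ∀ {i j} → (r ⟨$⟩ʳ (ℓ ⟨$⟩ˡ (ℓ ⟨$⟩ʳ i))) Fin.< (r ⟨$⟩ʳ (ℓ ⟨$⟩ˡ (ℓ ⟨$⟩ʳ j))) → f₂ i < f₂ j
  r⁻ {i} {j} lt rewrite inverseˡ ℓ {i} | inverseˡ ℓ {j} =
    sorting-mono⁻ f₂ (λ {i} {j} → f₂-inj (all i) (all j)) lt

  to : ∀ {u v} → u ≢ v → Adj G u v → _
  to {u} {v} u≢v e with <-cmp (f₁ u) (f₁ v)
  ... | tri< lt _ _ = inj₂ (ℓ⁺ lt , r⁺ (Equivalence.to (adj (all u) (all v) lt) e))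
  ... | tri≈ _ eq _ = contradiction (f₁-inj (all u) (all v) eq) u≢v
  ... | tri> _ _ gt = inj₁ (ℓ⁺ gt , r⁺ (Equivalence.to (adj (all v) (all u) gt) (Graph.sym G e)))

  from : ∀ {u v} → _ → Adj G u v
  from {u} {v} (inj₁ (a , b)) = Graph.sym G (Equivalence.from (adj (all v) (all u) (ℓ⁻ a)) (r⁻ b))
  from {u} {v} (inj₂ (a , b)) = Equivalence.from (adj (all u) (all v) (ℓ⁻ a)) (r⁻ b)

-- Combining realizers

upperBound : ∀ {n} (h : Fin n → ℕ) → ∃ λ N → ∀ i → h i < N
upperBound {zero}  h = 0 , λ ()
upperBound {suc n} h with upperBound (h ∘ Fin.suc)
... | N , h<N = suc (h Fin.zero) + N , λ where
  Fin.zero    → m≤m+n _ N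
  (Fin.suc i) → ≤-trans (h<N i) (m≤n+m N _)

module _ {N : ℕ} where

  lex-< : ∀ {a a′ x x′} → x < N → a < a′ → a * N + x < a′ * N + x′
  lex-< {a} {a′} {x} {x′} x<N a<a′ = begin-strict
    a * N + x   <⟨ +-monoʳ-< (a * N) x<N ⟩
    a * N + N   ≡⟨ +-comm (a * N) N ⟩
    suc a * N   ≤⟨ *-monoˡ-≤ N a<a′ ⟩
    a′ * N      ≤⟨ m≤m+n _ x′ ⟩
    a′ * N + x′ ∎
    where open ≤-Reasoning

  lex-≡ : ∀ {a a′ x x′} → x < N → x′ < N → a * N + x ≡ a′ * N + x′ → a ≡ a′ × x ≡ x′
  lex-≡ {a} {a′} {x} {x′} x<N x′<N eq with <-cmp a a′
  ... | tri< lt _ _   = contradiction eq (<⇒≢ (lex-< x<N lt))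
  ... | tri≈ _ refl _ = refl , +-cancelˡ-≡ (a * N) x x′ eq
  ... | tri> _ _ gt   = contradiction (sym eq) (<⇒≢ (lex-< x′<N gt))

-- Ends of an order, and orders reversed or shifted by a label

data End : Set where
  lower upper : End

Beyond : End → ℕ → ℕ → Set
Beyond lower a t = t < a
Beyond upper a t = a < t

AtEnd : ∀ {n} → End → (Fin n → ℕ) → (A T : Fin n → Set) → Set
AtEnd e f A T = ∀ {i j} → A i → ¬ T i → T j → Beyond e (f i) (f j)

Preserves : ∀ {n} → (Fin n → Set) → (f g : Fin n → ℕ) → Set
Preserves T f g = ∀ {i j} → T i → T j → f i < f j → g i < g j

-- By trichotomy for `f`, the order under `g` reflects to `f` and then passes on to `h`. Taking
-- `h = f` gives plain reflection; taking two extensions of one realizer transfers an order from one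
-- to the other.
preserves-reverse : ∀ {n} {T : Fin n → Set} {f g h : Fin n → ℕ} →
                    (∀ {i j} → T i → T j → f i ≡ f j → i ≡ j) →
                    Preserves T f g → Preserves T f h → Preserves T g h
preserves-reverse {f = f} inj fg fh {i} {j} ti tj gi<gj with <-cmp (f i) (f j)
... | tri< lt _ _ = fh ti tj lt
... | tri≈ _ eq _ with refl ← inj ti tj eq = contradiction gi<gj (<-irrefl refl)
... | tri> _ _ gt = contradiction gi<gj (<⇒≯ (fg tj ti gt))

-- For x before y in the first order, b tells whether the second order inverts them.
Crossed : Bool → ℕ → ℕ → Set
Crossed b x y = if b then y < x else x < y

crossed-map : ∀ b {x y x′ y′} → (x < y → x′ < y′) → (y < x → y′ < x′) → Crossed b x y → Crossed b x′ y′
crossed-map true  _ f = f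
crossed-map false f _ = f

crossed-≢ : ∀ b {x y} → Crossed b x y → x ≢ y
crossed-≢ true  y<x eq = <⇒≢ y<x (sym eq)
crossed-≢ false x<y eq = <⇒≢ x<y eq

crossed-adj : ∀ b {P : Set} {x y} → (if b then P else ¬ P) → Crossed b x y → P ⇔ y < x
crossed-adj true  p  y<x = mk⇔ (λ _ → y<x) (λ _ → p)
crossed-adj false ¬p x<y = mk⇔ (λ p → contradiction p ¬p) (λ y<x → contradiction y<x (<⇒≯ x<y))

reverseIf : Bool → ℕ → ℕ → ℕ
reverseIf b K k = if b then K ∸ k else k

reverseIf-inj : ∀ b {K k l} → k ≤ K → l ≤ K → reverseIf b K k ≡ reverseIf b K l → k ≡ l
reverseIf-inj true  k≤K l≤K = ∸-cancelˡ-≡ k≤K l≤K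
reverseIf-inj false _   _   = id

reverseIf-crossed : ∀ b {K k l} → k < l → l ≤ K → Crossed b (reverseIf b K k) (reverseIf b K l)
reverseIf-crossed true  k<l l≤K = ∸-monoʳ-< k<l l≤K
reverseIf-crossed false k<l _   = k<l

shiftIf : Bool → ℕ → ℕ → ℕ
shiftIf b N k = if b then N + k else k

shiftIf-< : ∀ b {N k l} → k < l → shiftIf b N k < shiftIf b N l
shiftIf-< true  {N} = +-monoʳ-< N
shiftIf-< false     = id

shiftIf-crossed : ∀ b {N k l} → k < N → l < N → Crossed b (shiftIf b N k) (shiftIf (not b) N l)
shiftIf-crossed true  k<N l<N = ≤-trans l<N (m≤m+n _ _)
shiftIf-crossed false k<N l<N = ≤-trans k<N (m≤m+n _ _)

sideEnd : Bool → End
sideEnd true  = upper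
sideEnd false = lower

-- Here `t` is the key of a point of the overlap and `y` that of a point outside it. That `t` comes
-- first is possible only when the overlap sits at the lower end, so `b` is `false` and `Crossed`
-- means `<`.
crossed-fromBelow : ∀ b {t y x x′} → Beyond (sideEnd b) y t → t < y → Crossed b x x′ → x < x′
crossed-fromBelow true  y<t t<y _    = contradiction t<y (<⇒≯ y<t)
crossed-fromBelow false _   _   x<x′ = x<x′

crossed-fromAbove : ∀ b {t y x x′} → Beyond (sideEnd b) y t → y < t → Crossed b x x′ → x′ < x
crossed-fromAbove true  _   _   x′<x = x′<x
crossed-fromAbove false t<y y<t _    = contradiction t<y (<⇒≯ y<t)

module Realizers {n} (Adj : Fin n → Fin n → Set) (adj-sym : ∀ {i j} → Adj i j → Adj j i) where

  open Realizer public
  Rlz : (Fin n → Set) → Set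
  Rlz = Realizer Adj

  record Extends {T S : Fin n → Set} (ρ : Rlz S) (E : Rlz T) : Set where
    field
      ext₁ : Preserves T (f₁ E) (f₁ ρ)
      ext₂ : Preserves T (f₂ E) (f₂ ρ)
  open Extends public

  restrict : ∀ {S T : Fin n → Set} → (∀ {i} → T i → S i) → Rlz S → Rlz T
  restrict T⊆S ρ = record
    { f₁ = f₁ ρ ; f₂ = f₂ ρ
    ; f₁-inj = λ ti tj → f₁-inj ρ (T⊆S ti) (T⊆S tj)
    ; f₂-inj = λ ti tj → f₂-inj ρ (T⊆S ti) (T⊆S tj)
    ; adj = λ ti tj → adj ρ (T⊆S ti) (T⊆S tj)
    }

  subsingleton : ∀ {S : Fin n → Set} → (∀ {i j} → S i → S j → i ≡ j) → Rlz S
  subsingleton one = record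
    { f₁ = λ _ → 0 ; f₂ = λ _ → 0
    ; f₁-inj = λ si sj _ → one si sj
    ; f₂-inj = λ si sj _ → one si sj
    ; adj = λ _ _ ()
    }

  swap : ∀ {S : Fin n → Set} → Rlz S → Rlz S
  swap {S} ρ = record
    { f₁ = f₂ ρ ; f₂ = f₁ ρ ; f₁-inj = f₂-inj ρ ; f₂-inj = f₁-inj ρ ; adj = adj′ }
    where
    adj′ : ∀ {i j} → S i → S j → f₂ ρ i < f₂ ρ j → Adj i j ⇔ f₁ ρ j < f₁ ρ i
    adj′ {i} {j} si sj lt₂ with <-cmp (f₁ ρ i) (f₁ ρ j)
    ... | tri< lt _ _ = mk⇔ (λ e → contradiction (Equivalence.to (adj ρ si sj lt) e) (<⇒≯ lt₂))
                            (λ gt → contradiction gt (<⇒≯ lt))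
    ... | tri≈ _ eq _ with refl ← f₁-inj ρ si sj eq = contradiction lt₂ (<-irrefl refl)
    ... | tri> _ _ gt = mk⇔ (λ _ → gt) (λ _ → adj-sym (Equivalence.from (adj ρ sj si gt) lt₂))

  Uniform : Bool → Fin n → Fin n → Set
  Uniform b i j = if b then Adj i j else ¬ Adj i j

  -- Keys are `class number * N + inner key` with inner keys below `N`. The numbering `ν` stays a
  -- parameter because a vertex on a side of a cycle must place one chosen class at a prescribed
  -- end.
  module Lexicographic {m} (S : Fin n → Set) (cl : Fin n → Fin m)
    (ν : Fin m → ℕ) (ν-inj : Injective _≡_ _≡_ ν) (b : Bool)
    (uniform : ∀ {i j} → S i → S j → cl i ≢ cl j → Uniform b i j)
    (ρ : ∀ k → Rlz (λ i → S i × cl i ≡ k)) where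

    private
      K : ℕ
      K = proj₁ (upperBound ν)

      ν₂ : Fin m → ℕ
      ν₂ k = reverseIf b K (ν k)

      ν≤K : ∀ k → ν k ≤ K
      ν≤K k = <⇒≤ (proj₂ (upperBound ν) k)

      ν₂-inj : Injective _≡_ _≡_ ν₂
      ν₂-inj {k} {l} eq = ν-inj (reverseIf-inj b (ν≤K k) (ν≤K l) eq)

      g₁ g₂ : Fin n → ℕ
      g₁ i = f₁ (ρ (cl i)) i
      g₂ i = f₂ (ρ (cl i)) i

      N₁ N₂ : ℕ
      N₁ = proj₁ (upperBound g₁)
      N₂ = proj₁ (upperBound g₂)

      F₁ F₂ : Fin n → ℕ
      F₁ i = ν  (cl i) * N₁ + g₁ i
      F₂ i = ν₂ (cl i) * N₂ + g₂ i

      F₂-< : ∀ {i j} → ν₂ (cl i) < ν₂ (cl j) → F₂ i < F₂ j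
      F₂-< {i} lt = lex-< (proj₂ (upperBound g₂) i) lt

    across : ∀ {i j} → ν (cl i) < ν (cl j) → F₁ i < F₁ j
    across {i} lt = lex-< (proj₂ (upperBound g₁) i) lt

    private
      across₂ : ∀ {i j} → ν (cl i) < ν (cl j) → Uniform b i j → Adj i j ⇔ F₂ j < F₂ i
      across₂ {i} {j} lt u = crossed-adj b u
        (crossed-map b F₂-< F₂-< (reverseIf-crossed b lt (ν≤K (cl j))))

      inj-F₁ : ∀ {i j} → S i → S j → F₁ i ≡ F₁ j → i ≡ j
      inj-F₁ {i} {j} si sj eq with lex-≡ (proj₂ (upperBound g₁) i) (proj₂ (upperBound g₁) j) eq
      ... | ν≡ , g≡ = f₁-inj (ρ (cl i)) (si , refl) (sj , sym k≡)
                        (trans g≡ (cong (λ k → f₁ (ρ k) j) (sym k≡)))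
        where k≡ = ν-inj ν≡

      inj-F₂ : ∀ {i j} → S i → S j → F₂ i ≡ F₂ j → i ≡ j
      inj-F₂ {i} {j} si sj eq with lex-≡ (proj₂ (upperBound g₂) i) (proj₂ (upperBound g₂) j) eq
      ... | ν≡ , g≡ = f₂-inj (ρ (cl i)) (si , refl) (sj , sym k≡)
                        (trans g≡ (cong (λ k → f₂ (ρ k) j) (sym k≡)))
        where k≡ = ν₂-inj ν≡

    within₁ : ∀ {k} → Preserves (λ i → S i × cl i ≡ k) (f₁ (ρ k)) F₁
    within₁ {i = i} {j} (_ , refl) (_ , eq) lt =
      subst (λ k → F₁ i < ν k * N₁ + f₁ (ρ k) j) (sym eq) (+-monoʳ-< (ν (cl i) * N₁) lt)

    within₂ : ∀ {k} → Preserves (λ i → S i × cl i ≡ k) (f₂ (ρ k)) F₂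
    within₂ {i = i} {j} (_ , refl) (_ , eq) lt =
      subst (λ k → F₂ i < ν₂ k * N₂ + f₂ (ρ k) j) (sym eq) (+-monoʳ-< (ν₂ (cl i) * N₂) lt)

    private
      F-adj : ∀ {i j} → S i → S j → F₁ i < F₁ j → Adj i j ⇔ F₂ j < F₂ i
      F-adj {i} {j} si sj lt with <-cmp (ν (cl i)) (ν (cl j))
      ... | tri< ν< k≢ _ = across₂ ν< (uniform si sj (k≢ ∘ cong ν))
      ... | tri> _ _ ν> = contradiction lt (<⇒≯ (across ν>))
      ... | tri≈ _ ν≡ _ = mk⇔
          (λ e → within₂ sj′ si′ (Equivalence.to (adj (ρ (cl i)) si′ sj′ lt′) e))
          (λ gt → Equivalence.from (adj (ρ (cl i)) si′ sj′ lt′) (back₂ gt))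
        where
        si′ = si , refl
        sj′ = sj , sym (ν-inj ν≡)

        back₁ : F₁ i < F₁ j → f₁ (ρ (cl i)) i < f₁ (ρ (cl i)) j
        back₁ = preserves-reverse {T = λ k → S k × cl k ≡ cl i} {h = f₁ (ρ (cl i))}
                  (f₁-inj (ρ (cl i))) (within₁ {cl i}) (λ _ _ → id) si′ sj′
        lt′ = back₁ lt

        back₂ : F₂ j < F₂ i → f₂ (ρ (cl i)) j < f₂ (ρ (cl i)) i
        back₂ = preserves-reverse {T = λ k → S k × cl k ≡ cl i} {h = f₂ (ρ (cl i))}
                  (f₂-inj (ρ (cl i))) (within₂ {cl i}) (λ _ _ → id) sj′ si′

    realizer : Rlz S
    realizer = record { f₁ = F₁ ; f₂ = F₂ ; f₁-inj = inj-F₁ ; f₂-inj = inj-F₂ ; adj = F-adj }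

  -- `F₁` agrees with `β` on `B` by construction, and with `α` on `A` because `α-end` puts the
  -- overlap last. `F₂` agrees with `α` on `A` by construction, and with `β` on `B` because `β-end`
  -- puts the overlap on the side where the block of `A` goes. Only pairs between the two
  -- differences remain, and these are uniform.
  module Overlap {A B : Fin n → Set} (A? : ∀ i → Dec (A i)) (B? : ∀ i → Dec (B i)) (b : Bool)
    (uniform : ∀ {i j} → A i → ¬ B i → B j → ¬ A j → Uniform b i j)
    (E : Rlz (λ i → A i × B i)) (α : Rlz A) (β : Rlz B) (αE : Extends α E) (βE : Extends β E)
    (α-end : AtEnd upper (f₁ α) A (λ i → A i × B i))
    (β-end : AtEnd (sideEnd b) (f₂ β) B (λ i → A i × B i)) where

    private
      N₁ : ℕ
      N₁ = proj₁ (upperBound (f₁ α))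

      F₁ : Fin n → ℕ
      F₁ i with B? i
      ... | yes _ = N₁ + f₁ β i
      ... | no  _ = f₁ α i

      F₁-β : Preserves B (f₁ β) F₁
      F₁-β {i} {j} bi bj lt with B? i | B? j
      ... | yes _ | yes _ = +-monoʳ-< N₁ lt
      ... | no ¬bi | _ = contradiction bi ¬bi
      ... | yes _ | no ¬bj = contradiction bj ¬bj

      F₁-αβ : ∀ {i j} → ¬ B i → B j → F₁ i < F₁ j
      F₁-αβ {i} {j} ¬bi bj with B? i | B? j
      ... | no _  | yes _ = ≤-trans (proj₂ (upperBound (f₁ α)) i) (m≤m+n _ _)
      ... | yes bi | _ = contradiction bi ¬bi
      ... | _ | no ¬bj = contradiction bj ¬bj

      F₁-α : Preserves A (f₁ α) F₁
      F₁-α {i} {j} ai aj lt with B? i | B? j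
      ... | no _ | no _ = lt
      ... | no _ | yes _ = ≤-trans (proj₂ (upperBound (f₁ α)) i) (m≤m+n _ _)
      -- Now `i` is in the overlap and `j` is not, so `α-end` puts `j` before `i`.
      ... | yes bi | no ¬bj = contradiction lt (<⇒≯ (α-end aj (¬bj ∘ proj₂) (ai , bi)))
      -- On the overlap `α` and `β` both follow `E`, so the order of `α` carries over to `β`.
      ... | yes bi | yes bj = +-monoʳ-< N₁
            (preserves-reverse {T = λ k → A k × B k} {h = f₁ β} (f₁-inj E) (ext₁ αE) (ext₁ βE)
               (ai , bi) (aj , bj) lt)

      N₂ : ℕ
      N₂ = proj₁ (upperBound (f₂ α)) + proj₁ (upperBound (f₂ β))

      f₂α<N₂ : ∀ i → f₂ α i < N₂
      f₂α<N₂ i = ≤-trans (proj₂ (upperBound (f₂ α)) i) (m≤m+n _ _)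

      f₂β<N₂ : ∀ i → f₂ β i < N₂
      f₂β<N₂ i = ≤-trans (proj₂ (upperBound (f₂ β)) i) (m≤n+m _ _)

      F₂ : Fin n → ℕ
      F₂ i with A? i
      ... | yes _ = shiftIf b N₂ (f₂ α i)
      ... | no  _ = shiftIf (not b) N₂ (f₂ β i)

      F₂-α : Preserves A (f₂ α) F₂
      F₂-α {i} {j} ai aj lt with A? i | A? j
      ... | yes _ | yes _ = shiftIf-< b lt
      ... | no ¬ai | _ = contradiction ai ¬ai
      ... | _ | no ¬aj = contradiction aj ¬aj

      F₂-αβ : ∀ {i j} → A i → ¬ A j → Crossed b (F₂ i) (F₂ j)
      F₂-αβ {i} {j} ai ¬aj with A? i | A? j
      ... | yes _ | no _ = shiftIf-crossed b (f₂α<N₂ i) (f₂β<N₂ j)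
      ... | no ¬ai | _ = contradiction ai ¬ai
      ... | _ | yes aj = contradiction aj ¬aj

      F₂-β : Preserves B (f₂ β) F₂
      F₂-β {i} {j} bi bj lt = go (A? i) (A? j)
        where
        go : Dec (A i) → Dec (A j) → F₂ i < F₂ j
        go (yes ai) (yes aj) = F₂-α ai aj
          (preserves-reverse {T = λ k → A k × B k} {h = f₂ α} (f₂-inj E) (ext₂ βE) (ext₂ αE)
             (ai , bi) (aj , bj) lt)
        go (yes ai) (no ¬aj) = crossed-fromBelow b (β-end bj (¬aj ∘ proj₁) (ai , bi)) lt (F₂-αβ ai ¬aj)
        go (no ¬ai) (yes aj) = crossed-fromAbove b (β-end bi (¬ai ∘ proj₁) (aj , bj)) lt (F₂-αβ aj ¬ai)
        go (no ¬ai) (no ¬aj) with A? i | A? j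
        ... | yes ai | _ = contradiction ai ¬ai
        ... | _ | yes aj = contradiction aj ¬aj
        ... | no _ | no _ = shiftIf-< (not b) lt

      crossing : ∀ {i j} → A i → ¬ B i → B j → ¬ A j → Adj i j ⇔ F₂ j < F₂ i
      crossing ai ¬bi bj ¬aj = crossed-adj b (uniform ai ¬bi bj ¬aj) (F₂-αβ ai ¬aj)

      monotone-inj : ∀ {S : Fin n → Set} {f g : Fin n → ℕ} →
                     (∀ {i j} → S i → S j → f i ≡ f j → i ≡ j) → Preserves S f g →
                     ∀ {i j} → S i → S j → g i ≡ g j → i ≡ j
      monotone-inj {f = f} inj fg {i} {j} si sj eq with <-cmp (f i) (f j)
      ... | tri< lt _ _ = contradiction eq (<⇒≢ (fg si sj lt))
      ... | tri≈ _ f≡ _ = inj si sj f≡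
      ... | tri> _ _ gt = contradiction (sym eq) (<⇒≢ (fg sj si gt))

      transport-adj : ∀ {S : Fin n → Set} (σ : Rlz S) → Preserves S (f₁ σ) F₁ → Preserves S (f₂ σ) F₂ →
                  ∀ {i j} → S i → S j → F₁ i < F₁ j → Adj i j ⇔ F₂ j < F₂ i
      transport-adj {S} σ p₁ p₂ si sj lt = mk⇔
        (λ e → p₂ sj si (Equivalence.to (adj σ si sj lt′) e))
        (λ gt → Equivalence.from (adj σ si sj lt′)
                  (preserves-reverse {T = S} {h = f₂ σ} (f₂-inj σ) p₂ (λ _ _ → id) sj si gt))
        where lt′ = preserves-reverse {T = S} {h = f₁ σ} (f₁-inj σ) p₁ (λ _ _ → id) si sj lt

      data Cover (i j : Fin n) : Set where
        bothA  : A i → A j → Cover i j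
        bothB  : B i → B j → Cover i j
        onlyAB : A i → ¬ B i → B j → ¬ A j → Cover i j
        onlyBA : A j → ¬ B j → B i → ¬ A i → Cover i j

      cover : ∀ {i j} → A i ⊎ B i → A j ⊎ B j → Cover i j
      cover {i} {j} si sj with A? i | B? i | A? j | B? j
      ... | yes ai | _ | yes aj | _ = bothA ai aj
      ... | _ | yes bi | _ | yes bj = bothB bi bj
      ... | yes ai | no ¬bi | no ¬aj | yes bj = onlyAB ai ¬bi bj ¬aj
      ... | no ¬ai | yes bi | yes aj | no ¬bj = onlyBA aj ¬bj bi ¬ai
      cover (inj₁ ai) sj | no ¬ai | no _ | _ | _ = contradiction ai ¬ai
      cover (inj₂ bi) sj | no _ | no ¬bi | _ | _ = contradiction bi ¬bi
      cover si (inj₁ aj) | _ | _ | no ¬aj | no _ = contradiction aj ¬aj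
      cover si (inj₂ bj) | _ | _ | no _ | no ¬bj = contradiction bj ¬bj

    realizer : Rlz (λ i → A i ⊎ B i)
    realizer = record
      { f₁ = F₁ ; f₂ = F₂
      ; f₁-inj = λ si sj → inj-F₁ (cover si sj)
      ; f₂-inj = λ si sj → inj-F₂ (cover si sj)
      ; adj = λ si sj → F-adj (cover si sj)
      }
      where
      inj-F₁ : ∀ {i j} → Cover i j → F₁ i ≡ F₁ j → i ≡ j
      inj-F₁ (bothA ai aj) = monotone-inj {f = f₁ α} (f₁-inj α) F₁-α ai aj
      inj-F₁ (bothB bi bj) = monotone-inj {f = f₁ β} (f₁-inj β) F₁-β bi bj
      inj-F₁ (onlyAB _ ¬bi bj _) eq = contradiction eq (<⇒≢ (F₁-αβ ¬bi bj))
      inj-F₁ (onlyBA _ ¬bj bi _) eq = contradiction (sym eq) (<⇒≢ (F₁-αβ ¬bj bi))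

      inj-F₂ : ∀ {i j} → Cover i j → F₂ i ≡ F₂ j → i ≡ j
      inj-F₂ (bothA ai aj) = monotone-inj {f = f₂ α} (f₂-inj α) F₂-α ai aj
      inj-F₂ (bothB bi bj) = monotone-inj {f = f₂ β} (f₂-inj β) F₂-β bi bj
      inj-F₂ (onlyAB ai _ _ ¬aj) eq = contradiction eq (crossed-≢ b (F₂-αβ ai ¬aj))
      inj-F₂ (onlyBA aj _ _ ¬ai) eq = contradiction (sym eq) (crossed-≢ b (F₂-αβ aj ¬ai))

      F-adj : ∀ {i j} → Cover i j → F₁ i < F₁ j → Adj i j ⇔ F₂ j < F₂ i
      F-adj (bothA ai aj) lt = transport-adj α F₁-α F₂-α ai aj lt
      F-adj (bothB bi bj) lt = transport-adj β F₁-β F₂-β bi bj lt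
      F-adj (onlyAB ai ¬bi bj ¬aj) _ = crossing ai ¬bi bj ¬aj
      F-adj (onlyBA aj ¬bj bi ¬ai) lt = contradiction lt (<⇒≯ (F₁-αβ ¬bj bi))

-- Double negation passes through a finite quantifier. Combined with excluded middle under double
-- negation, it lets a stable goal assume that a predicate on vertices is decidable.
¬¬-∀ : ∀ {m} {P : Fin m → Set} → (∀ i → ¬ ¬ P i) → ¬ ¬ (∀ i → P i)
¬¬-∀ {zero}  ¬¬P ¬∀ = ¬∀ λ ()
¬¬-∀ {suc m} ¬¬P ¬∀ = ¬¬P Fin.zero λ p → ¬¬-∀ (¬¬P ∘ Fin.suc) λ ps →
  ¬∀ λ { Fin.zero → p ; (Fin.suc i) → ps i }

-- Walks and biconnected sets

module _ {m} {A : Arcs m} where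

  walk-map : ∀ {S T : VSet m} → (∀ {w} → S w → T w) → ∀ {u v} → WalkIn A S u v → WalkIn A T u v
  walk-map f nil          = nil
  walk-map f (cons e s w) = cons e (f s) (walk-map f w)

  _++ʷ_ : ∀ {S : VSet m} {u v w} → WalkIn A S u v → WalkIn A S v w → WalkIn A S u w
  nil        ++ʷ q = q
  cons e s p ++ʷ q = cons e s (p ++ʷ q)

  walk-reverse : ∀ {S : VSet m} {u v} → S u → WalkIn A S u v → WalkIn A S v u
  walk-reverse su nil          = nil
  walk-reverse su (cons e s p) = walk-reverse s p ++ʷ cons (Sum.swap e) su nil

  connectedVia : ∀ {S : VSet m} h → (∀ w → S w → WalkIn A S w h) → ConnectedIn A S
  connectedVia h toHub u v su sv = toHub u su ++ʷ walk-reverse sv (toHub v sv)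

  Biconnected-resp : ∀ {S T : VSet m} → (∀ {w} → S w → T w) → (∀ {w} → T w → S w) →
                     Biconnected A S → Biconnected A T
  Biconnected-resp f g ((v , sv) , conn , conn-) =
    (v , f sv) ,
    (λ a b ta tb → walk-map f (conn a b (g ta) (g tb))) ,
    (λ r tr a b (ta , a≢r) (tb , b≢r) →
       walk-map (λ (s , ≢r) → f s , ≢r) (conn- r (g tr) a b (g ta , a≢r) (g tb , b≢r)))

  _∋ᵇ_ : (Fin m → Bool) → VSet m
  S ∋ᵇ v = S v ≡ true

  Decided : {S : VSet m} → (∀ v → Dec (S v)) → Fin m → Bool
  Decided S? v = does (S? v)

  Biconnected-does : ∀ {S : VSet m} (S? : ∀ v → Dec (S v)) → Biconnected A S → Biconnected A (Decided S? ∋ᵇ_)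
  Biconnected-does S? = Biconnected-resp (λ {w} → dec-true (S? w)) (λ {w} → does-true (S? w))

  avoiding : ∀ (S : Fin m → Bool) → Biconnected A (S ∋ᵇ_) → ∀ r → ConnectedIn A (λ w → S w ≡ true × w ≢ r)
  avoiding S (_ , conn , conn-) r with S r Boolₚ.≟ true
  ... | yes sr = conn- r sr
  ... | no ¬sr = λ a b (sa , _) (sb , _) →
        walk-map (λ sw → sw , λ { refl → ¬sr sw }) (conn a b sa sb)

  -- Quantifying over Boolean sets keeps Joint in Set; over VSet it would be in
  -- Set₁ and could not serve as a biconnected component.
  Joint : Fin m → Fin m → VSet m
  Joint a b v = Σ (Fin m → Bool) λ S → Biconnected A (S ∋ᵇ_) × S a ≡ true × S b ≡ true × S v ≡ true

  -- `Joint a b` is the union of all biconnected sets through `a` and `b`. Deleting one vertex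
  -- leaves `a` or `b` as a hub to which each of these sets stays connected. Any biconnected set
  -- that contains the union is itself one of the sets.
  Joint-component : ∀ {a b} → a ≢ b → Joint a b a → (∀ v → Dec (Joint a b v)) →
                    BiconnectedComponent A (Joint a b)
  Joint-component {a} {b} a≢b ja J? = ((a , ja) , conn , conn-) , maximal
    where
    conn : ConnectedIn A (Joint a b)
    conn = connectedVia a λ w (S , bic , sa , sb , sw) →
      walk-map (λ sv → S , bic , sa , sb , sv) (proj₁ (proj₂ bic) w a sw sa)

    through : ∀ r s → s ≢ r → (∀ {S : Fin m → Bool} → S a ≡ true → S b ≡ true → S s ≡ true) →
              ConnectedIn A (λ u → Joint a b u × u ≢ r)
    through r s s≢r s∈ = connectedVia s λ w ((S , bic , sa , sb , sw) , w≢r) →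
      walk-map (λ (sv , v≢r) → (S , bic , sa , sb , sv) , v≢r)
        (avoiding S bic r w s (sw , w≢r) (s∈ {S} sa sb , s≢r))

    conn- : ∀ r → Joint a b r → ConnectedIn A (λ u → Joint a b u × u ≢ r)
    conn- r _ with a ≟ r
    ... | no a≢r   = through r a a≢r (λ sa sb → sa)
    ... | yes refl = through r b (a≢b ∘ sym) (λ sa sb → sb)

    jb : Joint a b b
    jb = let S , bic , sa , sb , _ = ja in S , bic , sa , sb , sb

    maximal : ∀ C′ → Biconnected A C′ → (∀ v → Joint a b v → C′ v) → ∀ v → C′ v → Joint a b v
    maximal C′ bic ⊆C′ v cv = decidable-stable (J? v) λ ¬j →
      -- `C′` must be made Boolean to serve as a witness; this is allowed because the goal is stable
      -- by `J?`.
      ¬¬-∀ (λ w → ¬¬-excluded-middle) λ C′? →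
        ¬j (Decided C′? , Biconnected-does C′? bic
           , dec-true (C′? a) (⊆C′ a ja) , dec-true (C′? b) (⊆C′ b jb) , dec-true (C′? v) cv)

-- Reachability in acyclic digraphs

module Dag {m} (A : Arcs m) (acyclic : Acyclic A) where

  infix 4 _⟶_ _⇝_ _⇝?_ _≺_

  _⟶_ _⇝_ _≺_ : Fin m → Fin m → Set
  u ⟶ v = A u v ≡ true
  u ⇝ v = Path A u v
  v ≺ u = ∃ λ c → u ⟶ c × c ⇝ v

  _++_ : ∀ {u v w} → u ⇝ v → v ⇝ w → u ⇝ w
  here     ++ q = q
  step e p ++ q = step e (p ++ q)

  arc : ∀ {u v} → u ⟶ v → u ⇝ v
  arc e = step e here

  ⟶⇒≢ : ∀ {u v} → u ⟶ v → u ≢ v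
  ⟶⇒≢ e refl = acyclic _ _ e here

  ⇝-antisym : ∀ {u v} → u ⇝ v → v ⇝ u → u ≡ v
  ⇝-antisym here       q = refl
  ⇝-antisym (step e p) q = contradiction (p ++ q) (acyclic _ _ e)

  firstArc : ∀ {u v} → u ⇝ v → u ≡ v ⊎ v ≺ u
  firstArc here       = inj₁ refl
  firstArc (step e p) = inj₂ (_ , e , p)

  lastArc : ∀ {u v} → u ⇝ v → u ≡ v ⊎ ∃ λ p → u ⇝ p × p ⟶ v
  lastArc here = inj₁ refl
  lastArc (step e p) with lastArc p
  ... | inj₁ refl         = inj₂ (_ , here , e)
  ... | inj₂ (q , p′ , f) = inj₂ (q , step e p′ , f)

  ≺-isStrictPartialOrder : IsStrictPartialOrder _≡_ _≺_
  ≺-isStrictPartialOrder = record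
    { isEquivalence = isEquivalence
    ; irrefl = λ { refl (c , e , p) → acyclic _ c e p }
    ; trans = λ { (c , e , p) (d , f , q) → d , f , q ++ step e p }
    ; <-resp-≈ = (λ { refl → id }) , (λ { refl → id })
    }

  -- Finiteness makes the order of strict descendants well-founded both ways: `≺-wellFounded` serves
  -- recursion towards the leaves, `≻-wellFounded` towards the root.
  ≺-wellFounded : WellFounded _≺_
  ≺-wellFounded = FinInd.spo-wellFounded ≺-isStrictPartialOrder

  ≻-wellFounded : WellFounded (flip _≺_)
  ≻-wellFounded = FinInd.spo-noetherian ≺-isStrictPartialOrder

  _⟶?_ : ∀ u v → Dec (u ⟶ v)
  u ⟶? v = A u v Boolₚ.≟ true

  _⇝?_ : ∀ u v → Dec (u ⇝ v)
  u ⇝? v = go u (≺-wellFounded u)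
    where
    child? : ∀ u c → (u ⟶ c → Dec (c ⇝ v)) → Dec (u ⟶ c × c ⇝ v)
    child? u c rec with u ⟶? c
    ... | no ¬e = no (¬e ∘ proj₁)
    ... | yes e = map′ (e ,_) proj₂ (rec e)

    go : ∀ u → Acc _≺_ u → Dec (u ⇝ v)
    go u (acc rs) = map′
      (λ { (inj₁ refl) → here ; (inj₂ (c , e , p)) → step e p })
      firstArc
      (u ≟ v ⊎-dec any? (λ c → child? u c (λ e → go c (rs (c , e , here)))))

  pathWalk : ∀ {S : VSet m} {u v} → (∀ {w} → u ⇝ w → w ⇝ v → S w) → u ⇝ v → WalkIn A S u v
  pathWalk on here       = nil
  pathWalk on (step e p) = cons (inj₁ e) (on (arc e) p) (pathWalk (λ a b → on (step e a) b) p)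

  Common : Fin m → Fin m → VSet m
  Common c d y = c ⇝ y × d ⇝ y

  overlap? : ∀ c d → Dec (∃ (Common c d))
  overlap? c d = any? λ y → (c ⇝? y) ×-dec (d ⇝? y)

  -- Climb from `y` to strictly higher common descendants for as long as there are any.
  topmost : ∀ {c d y} → Common c d y →
            ∃ λ x → Common c d x × x ⇝ y × (∀ {z} → Common c d z → z ⇝ x → z ≡ x)
  topmost {c} {d} {y} cy = go y (≻-wellFounded y) cy
    where
    go : ∀ y → Acc (flip _≺_) y → Common c d y →
         ∃ λ x → Common c d x × x ⇝ y × (∀ {z} → Common c d z → z ⇝ x → z ≡ x)
    go y (acc rs) cy with any? (λ z → ((c ⇝? z) ×-dec (d ⇝? z)) ×-dec (z ⇝? y) ×-dec ¬? (z ≟ y))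
    ... | no none = y , cy , here , λ {z} cz z⇝y →
          decidable-stable (z ≟ y) λ z≢y → none (z , cz , z⇝y , z≢y)
    ... | yes (z , cz , z⇝y , z≢y) with firstArc z⇝y
    ...   | inj₁ z≡y = contradiction z≡y z≢y
    ...   | inj₂ y≺z with go z (rs y≺z) cz
    ...     | x , cx , x⇝z , top = x , cx , x⇝z ++ z⇝y , top

  Separates : Fin m → Fin m → Fin m → Set
  Separates s a b = s ⇝ a × s ⇝ b × (∀ {e} → s ⟶ e → e ⇝ a → ¬ e ⇝ b)

  -- Descend from `u` for as long as some child still reaches both targets.
  lowest : ∀ {u a b} → u ⇝ a → u ⇝ b → ∃ λ s → u ⇝ s × Separates s a b
  lowest {u} {a} {b} = go u (≺-wellFounded u)
    where
    go : ∀ u → Acc _≺_ u → u ⇝ a → u ⇝ b → ∃ λ s → u ⇝ s × Separates s a b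
    go u (acc rs) ua ub with any? (λ e → (u ⟶? e) ×-dec (e ⇝? a) ×-dec (e ⇝? b))
    ... | no none = u , here , ua , ub , λ ue ea eb → none (_ , ue , ea , eb)
    ... | yes (e , ue , ea , eb) with go e (rs (e , ue , here)) ea eb
    ...   | s , es , sep = s , step ue es , sep

  separates⇒lca : ∀ {s a b} → Separates s a b → IsLCA A a b s
  separates⇒lca (sa , sb , sep) = sa , sb , λ w wa wb sw → helper w wa wb sw
    where
    helper : ∀ w → w ⇝ _ → w ⇝ _ → _ ⇝ w → w ≡ _
    helper w wa wb here        = refl
    helper w wa wb (step e ew) = contradiction (ew ++ wb) (sep e (ew ++ wa))

  -- Diamonds, their blocks and the parents of their bottom vertex

  record Diamond (u c c′ x : Fin m) : Set where
    constructor diamond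
    field
      arcˡ : u ⟶ c
      arcʳ : u ⟶ c′
      c≢c′ : c ≢ c′
      toˡ  : c ⇝ x
      toʳ  : c′ ⇝ x
      top  : ∀ {z} → Common c c′ z → z ⇝ x → z ≡ x

  Diamond-sym : ∀ {u c c′ x} → Diamond u c c′ x → Diamond u c′ c x
  Diamond-sym (diamond e e′ c≢c′ p p′ top) =
    diamond e′ e (c≢c′ ∘ sym) p′ p (λ (a , b) → top (b , a))

  diamondAbove : ∀ {u c c′ y} → u ⟶ c → u ⟶ c′ → c ≢ c′ → c ⇝ y → c′ ⇝ y →
                 ∃ λ x → Diamond u c c′ x × x ⇝ y
  diamondAbove e e′ c≢c′ p p′ with topmost (p , p′)
  ... | x , (q , q′) , x⇝y , top = x , diamond e e′ c≢c′ q q′ top , x⇝y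

  -- For a diamond, the union of all paths from u through c or c′ to x.
  Block : (u c c′ x : Fin m) → VSet m
  Block u c c′ x w = w ≡ u ⊎ ((c ⇝ w ⊎ c′ ⇝ w) × w ⇝ x)

  Block? : ∀ u c c′ x w → Dec (Block u c c′ x w)
  Block? u c c′ x w = (w ≟ u) ⊎-dec (((c ⇝? w) ⊎-dec (c′ ⇝? w)) ×-dec (w ⇝? x))

  Block-sym : ∀ {u c c′ x w} → Block u c c′ x w → Block u c′ c x w
  Block-sym = Sum.map₂ λ (s , p) → Sum.swap s , p

  module _ {u c c′ x} (D : Diamond u c c′ x) where
    open Diamond D

    private
      B : VSet m
      B = Block u c c′ x

    Block-walk : ∀ {T : VSet m} {w} → c ⇝ w → w ⇝ x →
                 (∀ {v} → c ⇝ v → v ⇝ w → T v) → WalkIn A (λ v → B v × T v) u w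
    Block-walk cw wx on =
      cons (inj₁ arcˡ) (inj₂ (inj₁ here , cw ++ wx) , on here cw)
        (pathWalk (λ cv vw → inj₂ (inj₁ cv , vw ++ wx) , on cv vw) cw)

    -- By `top`, the vertex `r` is not below `c′`, so the right side survives. A vertex that does
    -- not reach `r` descends to `x`; one that does lies on the left and climbs to `u`, then takes
    -- the right side.
    Block-avoidingˡ : ∀ {r} → c ⇝ r → r ⇝ x → r ≢ x →
                      ∀ w → B w × w ≢ r → WalkIn A (λ v → B v × v ≢ r) w x
    Block-avoidingˡ {r} cr rx r≢x = go
      where
      ¬c′r : ¬ c′ ⇝ r
      ¬c′r c′r = r≢x (top (cr , c′r) rx)

      u≢r : u ≢ r
      u≢r refl = acyclic _ _ arcˡ cr

      fromRoot : WalkIn A (λ v → B v × v ≢ r) u x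
      fromRoot =
        cons (inj₁ arcʳ) (inj₂ (inj₂ here , toʳ) , λ { refl → ¬c′r here })
          (pathWalk (λ c′v vx → inj₂ (inj₂ c′v , vx) , λ { refl → ¬c′r c′v }) toʳ)

      go : ∀ w → B w × w ≢ r → WalkIn A (λ v → B v × v ≢ r) w x
      go w (inj₁ refl , _) = fromRoot
      go w (inj₂ (side , wx) , w≢r) with w ⇝? r
      ... | no ¬wr = pathWalk (λ wv vx → inj₂ (Sum.map (_++ wv) (_++ wv) side , vx)
                                        , λ { refl → ¬wr wv }) wx
      go w (inj₂ (inj₂ c′w , wx) , w≢r) | yes wr = contradiction (c′w ++ wr) ¬c′r
      go w (inj₂ (inj₁ cw , wx) , w≢r)  | yes wr =
        walk-reverse (inj₁ refl , u≢r)
          (Block-walk cw wx (λ { _ rw refl → w≢r (⇝-antisym wr rw) })) ++ʷ fromRoot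

  Block-connected : ∀ {u c c′ x} → Diamond u c c′ x → ConnectedIn A (Block u c c′ x)
  Block-connected {u} {c} {c′} {x} D = connectedVia u toRoot
    where
    open Diamond D
    toRoot : ∀ w → Block u c c′ x w → WalkIn A (Block u c c′ x) w u
    toRoot w (inj₁ refl) = nil
    toRoot w (inj₂ (inj₁ cw , wx)) = walk-reverse (inj₁ refl)
      (walk-map proj₁ (Block-walk D {λ v → v ⇝ w} cw wx (λ _ vw → vw)))
    toRoot w (inj₂ (inj₂ cw , wx)) = walk-reverse (inj₁ refl)
      (walk-map (Block-sym ∘ proj₁) (Block-walk (Diamond-sym D) {λ v → v ⇝ w} cw wx (λ _ vw → vw)))

  -- Without `u` every vertex still descends to `x`, and without `x` every vertex still climbs to
  -- `u`. Removing any other vertex damages one side only.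
  Block-biconnected : ∀ {u c c′ x} → Diamond u c c′ x → Biconnected A (Block u c c′ x)
  Block-biconnected {u} {c} {c′} {x} D = (u , inj₁ refl) , Block-connected D , avoid
    where
    open Diamond D
    B-_ : Fin m → VSet m
    (B- r) v = Block u c c′ x v × v ≢ r

    avoid-u : ∀ w → (B- u) w → WalkIn A (B- u) w x
    avoid-u w (inj₁ eq , w≢u) = contradiction eq w≢u
    avoid-u w (inj₂ (inj₁ cw , wx) , _) = pathWalk
      (λ wv vx → inj₂ (inj₁ (cw ++ wv) , vx) , λ { refl → acyclic _ _ arcˡ (cw ++ wv) }) wx
    avoid-u w (inj₂ (inj₂ cw , wx) , _) = pathWalk
      (λ wv vx → inj₂ (inj₂ (cw ++ wv) , vx) , λ { refl → acyclic _ _ arcʳ (cw ++ wv) }) wx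

    avoid-x : ∀ w → (B- x) w → WalkIn A (B- x) w u
    avoid-x w (inj₁ refl , _) = nil
    avoid-x w (inj₂ (inj₁ cw , wx) , w≢x) = walk-reverse (inj₁ refl , λ { refl → acyclic _ _ arcˡ toˡ })
      (Block-walk D cw wx (λ { _ xw refl → w≢x (⇝-antisym wx xw) }))
    avoid-x w (inj₂ (inj₂ cw , wx) , w≢x) = walk-reverse (inj₁ refl , λ { refl → acyclic _ _ arcˡ toˡ })
      (walk-map (λ (b , v≢x) → Block-sym b , v≢x)
        (Block-walk (Diamond-sym D) cw wx (λ { _ xw refl → w≢x (⇝-antisym wx xw) })))

    avoid : ∀ r → Block u c c′ x r → ConnectedIn A (B- r)
    avoid r (inj₁ refl) = connectedVia x avoid-u
    avoid r (inj₂ (side , rx)) with r ≟ x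
    ... | yes refl = connectedVia u avoid-x
    avoid r (inj₂ (inj₁ cr , rx)) | no r≢x = connectedVia x (Block-avoidingˡ D cr rx r≢x)
    avoid r (inj₂ (inj₂ cr , rx)) | no r≢x = connectedVia x λ w (bw , w≢r) →
      walk-map (λ (b , v≢r) → Block-sym b , v≢r)
        (Block-avoidingˡ (Diamond-sym D) cr rx r≢x w (Block-sym bw , w≢r))

  -- A parent of `x` at which a path starting with the arc from `u` to `c` can arrive. The first
  -- alternative is the degenerate side, a single arc from `u` to `x`.
  Entry : (u c x p : Fin m) → Set
  Entry u c x p = p ⟶ x × ((p ≡ u × c ≡ x) ⊎ c ⇝ p)

  entry : ∀ {u c x} → u ⟶ c → c ⇝ x → ∃ (Entry u c x)
  entry {u} uc cx with lastArc cx
  ... | inj₁ refl           = u , uc , inj₁ (refl , refl)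
  ... | inj₂ (p , cp , px)  = p , px , inj₂ cp

  -- A common entry below both `c` and `c′` would be a common descendant strictly above `x`, against
  -- `top`; the degenerate sides contradict acyclicity or `c ≢ c′`.
  entries-distinct : ∀ {u c c′ x p p′} → Diamond u c c′ x → Entry u c x p → Entry u c′ x p′ → p ≢ p′
  entries-distinct D (_ , inj₁ (_ , refl)) (_ , inj₁ (_ , refl)) _ = Diamond.c≢c′ D refl
  entries-distinct D (_ , inj₁ (refl , _)) (_ , inj₂ c′u) refl = acyclic _ _ (Diamond.arcʳ D) c′u
  entries-distinct D (_ , inj₂ cu) (_ , inj₁ (refl , _)) refl = acyclic _ _ (Diamond.arcˡ D) cu
  entries-distinct D (px , inj₂ cp) (_ , inj₂ c′p) refl =
    ⟶⇒≢ px (Diamond.top D (cp , c′p) (arc px))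

-- Diamonds in galled-trees

module Galled {m} (A : Arcs m) (acyclic : Acyclic A)
  (hybrid-indeg : ∀ {x p q} → A p x ≡ true → A q x ≡ true → p ≢ q → indeg A x ≡ 2)
  (galled : ∀ (C : VSet m) → BiconnectedComponent A C → ∀ h h′ →
            C h → indeg A h ≡ 2 → (∀ u → A u h ≡ true → C u) →
            C h′ → indeg A h′ ≡ 2 → (∀ u → A u h′ ≡ true → C u) → h ≡ h′) where

  open Dag A acyclic public

  noThreeParents : ∀ {x p q r} → p ⟶ x → q ⟶ x → r ⟶ x → p ≢ q → p ≢ r → ¬ q ≢ r
  noThreeParents px qx rx p≢q p≢r q≢r = contradiction
    (subst (3 ≤_) (hybrid-indeg px qx p≢q) (countTrue≥3 _ px qx rx p≢q p≢r q≢r))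
    λ { (s≤s (s≤s ())) }

  -- The entries of the two sides are already two distinct parents, and there is no third. This
  -- supplies the condition of (N4) that the in-neighbours of the hybrid lie in the component.
  parents-in-Block : ∀ {u c c′ x q} → Diamond u c c′ x → q ⟶ x → Block u c c′ x q
  parents-in-Block {q = q} D qx
    with entry (Diamond.arcˡ D) (Diamond.toˡ D) | entry (Diamond.arcʳ D) (Diamond.toʳ D)
  ... | p , ep | p′ , ep′ with p ≟ q | p′ ≟ q
  ...   | no p≢q | no p′≢q = contradiction p′≢q
            (noThreeParents (proj₁ ep) (proj₁ ep′) qx (entries-distinct D ep ep′) p≢q)
  ...   | yes refl | _ = Sum.map proj₁ (λ cp → inj₁ cp , arc qx) (proj₂ ep)
  ...   | _ | yes refl = Sum.map proj₁ (λ cp → inj₂ cp , arc qx) (proj₂ ep′)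

  diamond-indeg : ∀ {u c c′ x} → Diamond u c c′ x → indeg A x ≡ 2
  diamond-indeg D with entry (Diamond.arcˡ D) (Diamond.toˡ D) | entry (Diamond.arcʳ D) (Diamond.toʳ D)
  ... | p , ep | p′ , ep′ = hybrid-indeg (proj₁ ep) (proj₁ ep′) (entries-distinct D ep ep′)

  -- Both blocks lie in the biconnected component determined by a and b.
  sameHybrid : ∀ {u c c′ x v d d′ y a b} → Diamond u c c′ x → Diamond v d d′ y → a ≢ b →
               Block u c c′ x a → Block u c c′ x b → Block v d d′ y a → Block v d d′ y b → x ≡ y
  sameHybrid {u} {c} {c′} {x} {v} {d} {d′} {y} {a} {b} D D′ a≢b xa xb ya yb =
    -- Membership in `Joint a b` is decided only under double negation, which suffices since
    -- equality of vertices is stable.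
    decidable-stable (x ≟ y) λ x≢y → ¬¬-∀ (λ w → ¬¬-excluded-middle) λ J? →
      x≢y (galled (Joint a b) (Joint-component a≢b (inX xa) J?) x y
        (inX (inj₂ (inj₁ (Diamond.toˡ D) , here))) (diamond-indeg D) (λ q qx → inX (parents-in-Block D qx))
        (inY (inj₂ (inj₁ (Diamond.toˡ D′) , here))) (diamond-indeg D′) (λ q qy → inY (parents-in-Block D′ qy)))
    where
    X? = Block? u c c′ x
    Y? = Block? v d d′ y

    inX : ∀ {w} → Block u c c′ x w → Joint a b w
    inX {w} bw = Decided {A = A} X? , Biconnected-does X? (Block-biconnected D)
               , dec-true (X? a) xa , dec-true (X? b) xb , dec-true (X? w) bw

    inY : ∀ {w} → Block v d d′ y w → Joint a b w
    inY {w} bw = Decided {A = A} Y? , Biconnected-does Y? (Block-biconnected D′)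
               , dec-true (Y? a) ya , dec-true (Y? b) yb , dec-true (Y? w) bw

  root∈ : ∀ {u c c′ x} → Block u c c′ x u
  root∈ = inj₁ refl

  below : ∀ {u c c′ x w} → c ⇝ w → w ⇝ x → Block u c c′ x w
  below cw wx = inj₂ (inj₁ cw , wx)

  sharedArc : ∀ {u c c′ d x y} → Diamond u c c′ x → Diamond u c d y → x ≡ y
  sharedArc D D′ = sameHybrid D D′ (⟶⇒≢ (Diamond.arcˡ D)) root∈ (below here (Diamond.toˡ D))
                                                          root∈ (below here (Diamond.toˡ D′))

  -- A topmost common descendant above `y` gives a second diamond on the same arcs, and by
  -- `sharedArc` its hybrid is `x`. Hence the leaf sets of the two sides meet exactly in that of
  -- `x`.
  common⇒below : ∀ {u c c′ x y} → Diamond u c c′ x → c ⇝ y → c′ ⇝ y → x ⇝ y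
  common⇒below D cy c′y with diamondAbove (Diamond.arcˡ D) (Diamond.arcʳ D) (Diamond.c≢c′ D) cy c′y
  ... | z , D′ , z⇝y with refl ← sharedArc D D′ = z⇝y

  -- The three pairwise diamonds share arcs, hence one hybrid, and its three entries would be three
  -- parents.
  noThreeChildren : ∀ {u c d e y} → u ⟶ c → u ⟶ d → u ⟶ e → c ≢ d → c ≢ e → d ≢ e →
                    c ⇝ y → d ⇝ y → ¬ e ⇝ y
  noThreeChildren uc ud ue c≢d c≢e d≢e cy dy ey
    with diamondAbove uc ud c≢d cy dy | diamondAbove uc ue c≢e cy ey | diamondAbove ud ue d≢e dy ey
  ... | x , D₁ , _ | _ , D₂ , _ | _ , D₃ , _
    with refl ← sharedArc D₁ D₂ | refl ← sharedArc (Diamond-sym D₁) D₃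
    with entry uc (Diamond.toˡ D₁) | entry ud (Diamond.toʳ D₁) | entry ue (Diamond.toʳ D₂)
  ... | p , ep | q , eq | r , er =
    noThreeParents (proj₁ ep) (proj₁ eq) (proj₁ er)
      (entries-distinct D₁ ep eq) (entries-distinct D₂ ep er) (entries-distinct D₃ eq er)

  -- Both diamonds use the arc to `c`, so they have the same hybrid, which would lie below three
  -- children if `d` and `e` differed.
  overlap-unique : ∀ {u c d e} → u ⟶ c → u ⟶ d → u ⟶ e → c ≢ d → c ≢ e →
                   ∃ (Common c d) → ∃ (Common c e) → d ≡ e
  overlap-unique {d = d} {e} uc ud ue c≢d c≢e (y , cy , dy) (z , cz , ez)
    with diamondAbove uc ud c≢d cy dy | diamondAbove uc ue c≢e cz ez
  ... | x , D , _ | _ , D′ , _ with refl ← sharedArc D D′ =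
    decidable-stable (d ≟ e) λ d≢e →
      noThreeChildren uc ud ue c≢d c≢e d≢e (Diamond.toˡ D) (Diamond.toʳ D) (Diamond.toʳ D′)

  -- A diamond at s would have x as its hybrid, giving x a third parent besides
  -- the two entries through e and e′.
  sideChild-isolated : ∀ {u c c′ x s e e′} → Diamond u c c′ x → c ⇝ s → s ⟶ e → e ⇝ x →
                       s ⟶ e′ → e ≢ e′ → ¬ ∃ (Common e e′)
  sideChild-isolated {u} {c} {c′} {x} {s} {e} {e′} D cs se ex se′ e≢e′ (y , ey , e′y)
    with diamondAbove se se′ e≢e′ ey e′y
  ... | z , D′ , _ with refl ← sameHybrid D D′ (⟶⇒≢ se)
                         (below cs (step se ex)) (below (cs ++ arc se) ex)
                         root∈ (below here (Diamond.toˡ D′))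
    with entry se (Diamond.toˡ D′) | entry se′ (Diamond.toʳ D′) | entry (Diamond.arcʳ D) (Diamond.toʳ D)
  ... | p , ep | q , eq | r , er =
    noThreeParents (proj₁ ep) (proj₁ eq) (proj₁ er) (entries-distinct D′ ep eq)
      (distinct (leftOf ep se)) (distinct (leftOf eq se′))
    where
    leftOf : ∀ {d p} → Entry s d x p → s ⟶ d → Entry u c x p
    leftOf (px , inj₁ (refl , _)) sd = px , inj₂ cs
    leftOf (px , inj₂ dp)         sd = px , inj₂ (cs ++ step sd dp)

    distinct : ∀ {p} → Entry u c x p → p ≢ r
    distinct ep = entries-distinct D ep er

  -- If `q` and `x` were incomparable, the lowest vertex above both would have distinct children
  -- towards `q` and `x`. These overlap in `y`, against `sideChild-isolated`.
  gateway : ∀ {u c c′ x q y} → Diamond u c c′ x → c ⇝ q → q ⇝ y → x ⇝ y → q ⇝ x ⊎ x ⇝ q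
  gateway {x = x} {q} D cq qy xy with lowest cq (Diamond.toˡ D)
  ... | s , cs , sq , sx , sep with firstArc sq | firstArc sx
  ...   | inj₁ refl | _ = inj₁ sx
  ...   | inj₂ _ | inj₁ refl = inj₂ sq
  ...   | inj₂ (e₁ , se₁ , e₁q) | inj₂ (e₂ , se₂ , e₂x) =
    contradiction (_ , e₂x ++ xy , e₁q ++ qy)
      (sideChild-isolated D cs se₂ e₂x se₁ λ { refl → sep se₁ e₁q e₂x })

  -- If `v` and `w` are incomparable, a lowest vertex above both is the top of a diamond with hybrid
  -- `x` above `a`, and `gateway` compares `v` with `x`. If `x` reaches `v`, so does the child
  -- towards `w`. Otherwise a child of `v` reaches `x`, hence both `a` and `b`.
  lca-unique : ∀ {r v w a b} → r ⇝ v → r ⇝ w → Separates v a b → IsLCA A a b w → v ≡ w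
  lca-unique rv rw (va , vb , sep) (wa , wb , min) with lowest rv rw
  ... | u , _ , uv , uw , sepᵤ with firstArc uv | firstArc uw
  ...   | inj₁ refl | inj₁ refl = refl
  ...   | inj₁ refl | inj₂ (_ , ue , ew) = contradiction (ew ++ wb) (sep ue (ew ++ wa))
  ...   | inj₂ _ | inj₁ refl = min _ va vb uv
  ...   | inj₂ (c , uc , cv) | inj₂ (d , ud , dw)
    with diamondAbove uc ud (λ { refl → sepᵤ uc cv dw }) (cv ++ va) (dw ++ wa)
  ...     | x , D , xa with gateway D cv va xa
  ...       | inj₂ xv = contradiction dw (sepᵤ ud (Diamond.toʳ D ++ xv))
  ...       | inj₁ vx with firstArc vx
  ...         | inj₁ refl = contradiction dw (sepᵤ ud (Diamond.toʳ D))
  ...         | inj₂ (_ , ve , ex) = contradiction (ex ++ common⇒below D (cv ++ vb) (dw ++ wb)) (sep ve (ex ++ xa))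

-- Realizers along a galled-tree

-- A choice depending only on the values of `f`, so that children with the same linked siblings get
-- the same representative.
firstTrue : ∀ {m} → (Fin m → Bool) → Maybe (Fin m)
firstTrue {zero}  f = nothing
firstTrue {suc m} f = if f Fin.zero then just Fin.zero else Maybe.map Fin.suc (firstTrue (f ∘ Fin.suc))

firstTrue-cong : ∀ {m} {f g : Fin m → Bool} → f ≗ g → firstTrue f ≡ firstTrue g
firstTrue-cong {zero}  eq = refl
firstTrue-cong {suc m} eq = cong₂ (λ b k → if b then just Fin.zero else Maybe.map Fin.suc k)
  (eq Fin.zero) (firstTrue-cong (eq ∘ Fin.suc))

firstTrue-true : ∀ {m} (f : Fin m → Bool) {k} → f k ≡ true → ∃ λ j → firstTrue f ≡ just j × f j ≡ true
firstTrue-true {suc m} f {k} fk with f Fin.zero in f0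
... | true = Fin.zero , refl , f0
firstTrue-true {suc m} f {Fin.zero}  fk | false = contradiction (trans (sym f0) fk) λ ()
firstTrue-true {suc m} f {Fin.suc k} fk | false with firstTrue-true (f ∘ Fin.suc) fk
... | j , eq , fj = Fin.suc j , cong (Maybe.map Fin.suc) eq , fj

beyond-map : ∀ e {a t a′ t′} → (a < t → a′ < t′) → (t < a → t′ < a′) → Beyond e a t → Beyond e a′ t′
beyond-map upper f _ = f
beyond-map lower _ g = g

numbering : ∀ {m} → End → Fin m → Fin m → ℕ
-- `m` exceeds every `toℕ k`; in the lower case the shift by `suc` frees 0 for `s`.
numbering {m} upper s k = if does (k ≟ s) then m else toℕ k
numbering {m} lower s k = if does (k ≟ s) then 0 else suc (toℕ k)

numbering-injective : ∀ {m} e (s : Fin m) → Injective _≡_ _≡_ (numbering e s)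
numbering-injective upper s {k} {l} eq with k ≟ s | l ≟ s
... | yes refl | yes refl = refl
... | yes _ | no _ = contradiction (sym eq) (<⇒≢ (Finₚ.toℕ<n l))
... | no _ | yes _ = contradiction eq (<⇒≢ (Finₚ.toℕ<n k))
... | no _ | no _ = Finₚ.toℕ-injective eq
numbering-injective lower s {k} {l} eq with k ≟ s | l ≟ s
... | yes refl | yes refl = refl
... | no _ | no _ = Finₚ.toℕ-injective (suc-injective eq)

numbering-beyond : ∀ {m} e {s k : Fin m} → k ≢ s → Beyond e (numbering e s k) (numbering e s s)
numbering-beyond upper {s} {k} k≢s with k ≟ s | s ≟ s
... | yes eq | _ = contradiction eq k≢s
... | _ | no s≢s = contradiction refl s≢s
... | no _ | yes _ = Finₚ.toℕ<n k
numbering-beyond lower {s} {k} k≢s with k ≟ s | s ≟ s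
... | yes eq | _ = contradiction eq k≢s
... | _ | no s≢s = contradiction refl s≢s
... | no _ | yes _ = s≤s z≤n

isOne : Label → Bool
isOne oneL = true
isOne _    = false

module Explained {n m} (G : Graph n) (A : Arcs m) (acyclic : Acyclic A)
  (hybrid-indeg : ∀ {x p q} → A p x ≡ true → A q x ≡ true → p ≢ q → indeg A x ≡ 2)
  (galled : ∀ (C : VSet m) → BiconnectedComponent A C → ∀ h h′ →
            C h → indeg A h ≡ 2 → (∀ u → A u h ≡ true → C u) →
            C h′ → indeg A h′ ≡ 2 → (∀ u → A u h′ ≡ true → C u) → h ≡ h′)
  (root : Fin m) (rooted : ∀ v → Path A root v)
  (t : Fin m → Label) (φ : Fin n → Fin m) (φ-inj : ∀ i j → φ i ≡ φ j → i ≡ j)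
  (leaf : ∀ {i c} → A (φ i) c ≢ true)
  (explains : ∀ i j → i ≢ j → Adj G i j ⇔ (∃ λ w → IsLCA A (φ i) (φ j) w × t w ≡ oneL)) where

  open Galled A acyclic hybrid-indeg galled
  open Realizers (Adj G) (Graph.sym G)

  L : Fin m → Fin n → Set
  L u i = u ⇝ φ i

  -- For label 1 the vertex `v` is itself the required lca. For the other labels adjacency would
  -- give an lca labeled 1, which `lca-unique` identifies with `v`.
  separated⇒uniform : ∀ {v i j} → i ≢ j → Separates v (φ i) (φ j) → Uniform (isOne (t v)) i j
  separated⇒uniform {v} {i} {j} i≢j sep with t v in tv
  ... | oneL  = Equivalence.from (explains i j i≢j) (v , separates⇒lca sep , tv)
  ... | zeroL = λ e → let w , lca , tw = Equivalence.to (explains i j i≢j) e in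
        contradiction (trans (sym tv) (trans (cong t (lca-unique (rooted v) (rooted w) sep lca)) tw)) λ ()
  ... | odot  = λ e → let w , lca , tw = Equivalence.to (explains i j i≢j) e in
        contradiction (trans (sym tv) (trans (cong t (lca-unique (rooted v) (rooted w) sep lca)) tw)) λ ()

  Side : Fin m → Fin m → Set
  Side u x = ∀ e (E : Rlz (L x)) → Σ (Rlz (L u)) λ ρ → Extends ρ E × AtEnd e (f₁ ρ) (L u) (L x)

  -- Both fields are built in one induction: closing a cycle uses `side` for its two children and
  -- `whole` for the hybrid, and along a side the other groups of children again need `whole`.
  record Realized (u : Fin m) : Set where
    constructor realized
    field
      whole : Rlz (L u)
      side  : ∀ {v c c′ x} → Diamond v c c′ x → c ⇝ u → u ⇝ x → Side u x
  open Realized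

  pair : ∀ {v c c′ x} → Diamond v c c′ x → Realized c → Realized c′ → Realized x → Rlz (λ i → L c i ⊎ L c′ i)
  pair {v} {c} {c′} {x} D rc rc′ rx = Overlap.realizer {A = L c} {B = L c′}
    (λ i → c ⇝? φ i) (λ i → c′ ⇝? φ i) (isOne (t v)) uniform
    (restrict below-x E) α (swap β)
    (record { ext₁ = λ ti tj → ext₁ αE (below-x ti) (below-x tj)
            ; ext₂ = λ ti tj → ext₂ αE (below-x ti) (below-x tj) })
    (record { ext₁ = λ ti tj → ext₂ βE (below-x ti) (below-x tj)
            ; ext₂ = λ ti tj → ext₁ βE (below-x ti) (below-x tj) })
    (λ ai ¬ti tj → α-end ai (¬ti ∘ above-x) (below-x tj))
    (λ bi ¬ti tj → β-end bi (¬ti ∘ above-x) (below-x tj))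
    where
    open Diamond D
    E = whole rx

    sideˡ = side rc D here toˡ upper E
    α = proj₁ sideˡ
    αE = proj₁ (proj₂ sideˡ)
    α-end = proj₂ (proj₂ sideˡ)

    -- `Side` controls the end in the first order, whereas `β-end` concerns the second; hence
    -- `swap E` here and `swap β` above.
    sideʳ = side rc′ (Diamond-sym D) here toʳ (sideEnd (isOne (t v))) (swap E)
    β = proj₁ sideʳ
    βE = proj₁ (proj₂ sideʳ)
    β-end = proj₂ (proj₂ sideʳ)

    below-x : ∀ {i} → L c i × L c′ i → L x i
    below-x (ci , c′i) = common⇒below D ci c′i

    above-x : ∀ {i} → L x i → L c i × L c′ i
    above-x xi = toˡ ++ xi , toʳ ++ xi

    uniform : ∀ {i j} → L c i → ¬ L c′ i → L c′ j → ¬ L c j → Uniform (isOne (t v)) i j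
    -- A child of `v` reaching both leaves would differ from `c` and overlap it, hence be `c′`,
    -- which misses the first leaf.
    uniform ci ¬c′i c′j ¬cj = separated⇒uniform (λ { refl → ¬cj ci })
      (step arcˡ ci , step arcʳ c′j , λ ve ei ej →
        contradiction
          (overlap-unique arcˡ arcʳ ve c≢c′ (λ { refl → ¬cj ej }) (x , toˡ , toʳ) (_ , ci , ei))
          (λ { refl → ¬c′i ei }))

  Group : Fin m → Fin m → Fin n → Set
  Group v k i = ∃ λ c → v ⟶ c × ∃ (Common k c) × L c i

  -- By `overlap-unique` at most one sibling overlaps `k`, so the group is `L k` or the union of the
  -- two sides of one cycle.
  group : ∀ {v k} → (∀ {w} → w ≺ v → Realized w) → v ⟶ k → Rlz (Group v k)
  group {v} {k} ih vk with any? (λ c → (v ⟶? c) ×-dec ¬? (k ≟ c) ×-dec overlap? k c)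
  ... | no alone = restrict
        (λ (c , vc , o , ci) → subst (λ d → L d _)
           (sym (decidable-stable (k ≟ c) λ k≢c → alone (c , vc , k≢c , o))) ci)
        (whole (ih (k , vk , here)))
  ... | yes (d , vd , k≢d , y , ky , dy) with diamondAbove vk vd k≢d ky dy
  ...   | x , D , _ = restrict members
            (pair D (ih (k , vk , here)) (ih (d , vd , here)) (ih (k , vk , Diamond.toˡ D)))
    where
    members : ∀ {i} → Group v k i → L k i ⊎ L d i
    members (c , vc , o , ci) with k ≟ c
    ... | yes refl = inj₁ ci
    ... | no k≢c with refl ← overlap-unique vk vd vc k≢d k≢c (y , ky , dy) o = inj₂ ci

  module Node {v} (children : ∀ {i} → L v i → ∃ λ c → v ⟶ c × L c i)
              (groups : ∀ {k} → v ⟶ k → Rlz (Group v k))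
              (ν : Fin m → ℕ) (ν-inj : Injective _≡_ _≡_ ν) where

    private
      Linked : Fin m → Fin m → Set
      Linked c k = v ⟶ k × ∃ (Common k c)

      linked? : ∀ c k → Dec (Linked c k)
      linked? c k = (v ⟶? k) ×-dec overlap? k c

      -- If `c` overlaps both `c′` and `k` and differs from each, then `overlap-unique` forces
      -- `k ≡ c′`.
      linked-trans : ∀ {c c′ k} → v ⟶ c → v ⟶ c′ → ∃ (Common c c′) → Linked c k → Linked c′ k
      linked-trans {c} {c′} {k} vc vc′ o (vk , y , ky , cy) with c ≟ k | c ≟ c′
      ... | yes refl | _ = vk , o
      ... | no _ | yes refl = vk , y , ky , cy
      ... | no c≢k | no c≢c′ with refl ← overlap-unique vc vk vc′ c≢k c≢c′ (y , cy , ky) o =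
            vk , k , here , here

    rep : Fin m → Fin m
    -- The default `v` never occurs for a child `c`, since `c` is linked to itself.
    rep c = fromMaybe v (firstTrue (λ k → does (linked? c k)))

    rep-cong : ∀ {c c′} → v ⟶ c → v ⟶ c′ → ∃ (Common c c′) → rep c ≡ rep c′
    rep-cong {c} {c′} vc vc′ (y , cy , c′y) = cong (fromMaybe v) (firstTrue-cong λ k → does-⇔
      (mk⇔ (linked-trans vc vc′ (y , cy , c′y)) (linked-trans vc′ vc (y , c′y , cy)))
      (linked? c k) (linked? c′ k))

    rep-linked : ∀ {c} → v ⟶ c → Linked c (rep c)
    rep-linked {c} vc
      with firstTrue-true (λ k → does (linked? c k)) {c} (dec-true (linked? c c) (vc , c , here , here))
    ... | j , eq , fj = subst (Linked c) (sym (cong (fromMaybe v) eq)) (does-true (linked? c j) fj)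

    -- Whichever child is found, the class is the same: two children above one leaf overlap and
    -- share a representative. The default `v` is taken only by leaves below no child of `v`.
    cl : Fin n → Fin m
    cl i with any? (λ c → (v ⟶? c) ×-dec (c ⇝? φ i))
    ... | yes (c , _) = rep c
    ... | no _        = v

    cl≡rep : ∀ {c i} → v ⟶ c → L c i → cl i ≡ rep c
    cl≡rep {c} {i} vc ci with any? (λ c → (v ⟶? c) ×-dec (c ⇝? φ i))
    ... | yes (d , vd , di) = rep-cong vd vc (φ i , di , ci)
    ... | no none = contradiction (c , vc , ci) none

    classInGroup : ∀ {k i} → L v i × cl i ≡ k → v ⟶ k × Group v k i
    classInGroup (vi , eq) with children vi
    ... | c , vc , ci with subst (Linked c) (trans (sym (cl≡rep vc ci)) eq) (rep-linked vc)
    ...   | vk , o = vk , c , vc , o , ci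

    class : ∀ k → Dec (v ⟶ k) → Rlz (λ i → L v i × cl i ≡ k)
    class k (yes vk) = restrict (proj₂ ∘ classInGroup) (groups vk)
    -- Such a class is empty.
    class k (no ¬vk) = subsingleton λ ci → contradiction (proj₁ (classInGroup ci)) ¬vk

    uniform : ∀ {i j} → L v i → L v j → cl i ≢ cl j → Uniform (isOne (t v)) i j
    uniform vi vj ≢ = separated⇒uniform (≢ ∘ cong cl)
      (vi , vj , λ ve ei ej → ≢ (trans (cl≡rep ve ei) (sym (cl≡rep ve ej))))

    open Lexicographic (L v) cl ν ν-inj (isOne (t v)) uniform (λ k → class k (v ⟶? k)) public

    -- The hypothesis ranges over all proofs of the arc because `v ⟶? k` may return a different one
    -- from the given `vk`.
    group-preserved₁ : ∀ {k h} → v ⟶ k → (∀ vk → f₁ (groups {k} vk) ≡ h) →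
               Preserves (λ i → L v i × cl i ≡ k) h (f₁ realizer)
    group-preserved₁ {k} {h} vk eq {i} {j} ci cj lt = within₁ {k} {i} {j} ci cj (go (v ⟶? k))
      where
      go : ∀ d → f₁ (class k d) i < f₁ (class k d) j
      go (yes vk′) rewrite eq vk′ = lt
      go (no ¬vk)  = contradiction vk ¬vk

    group-preserved₂ : ∀ {k h} → v ⟶ k → (∀ vk → f₂ (groups {k} vk) ≡ h) →
               Preserves (λ i → L v i × cl i ≡ k) h (f₂ realizer)
    group-preserved₂ {k} {h} vk eq {i} {j} ci cj lt = within₂ {k} {i} {j} ci cj (go (v ⟶? k))
      where
      go : ∀ d → f₂ (class k d) i < f₂ (class k d) j
      go (yes vk′) rewrite eq vk′ = lt
      go (no ¬vk)  = contradiction vk ¬vk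

  inner : ∀ {u c i} → u ⟶ c → L u i → ∃ λ c → u ⟶ c × L c i
  inner uc ui with firstArc ui
  ... | inj₁ refl = contradiction uc leaf
  ... | inj₂ below = below

  realizeWhole : ∀ u → (∀ {w} → w ≺ u → Realized w) → Rlz (L u)
  realizeWhole u ih with any? (u ⟶?_)
  ... | no none = subsingleton λ ui uj → φ-inj _ _ (trans (sym (end ui)) (end uj))
    where
    end : ∀ {i} → L u i → u ≡ φ i
    end ui with firstArc ui
    ... | inj₁ eq = eq
    ... | inj₂ (c , uc , _) = contradiction (c , uc) none
  ... | yes (c , uc) = Node.realizer (inner uc) (group ih) toℕ Finₚ.toℕ-injective

  -- At `x` itself `E` is the answer. Otherwise take the child `s` towards `x`: by
  -- `sideChild-isolated` it forms a group alone, realized by induction with `L x` at the chosen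
  -- end, and `numbering` moves this group to that end.
  realizeSide : ∀ u → (∀ {w} → w ≺ u → Realized w) →
          ∀ {v c c′ x} → Diamond v c c′ x → c ⇝ u → u ⇝ x → Side u x
  realizeSide u ih {x = x} D cu ux end E with firstArc ux
  ... | inj₁ refl = E , record { ext₁ = λ _ _ → id ; ext₂ = λ _ _ → id } , λ ui ¬xi _ → contradiction ui ¬xi
  ... | inj₂ (s , us , sx) = realizer , extends , atEnd
    where
    σ-side = side (ih (s , us , here)) D (cu ++ arc us) sx end E
    σ = proj₁ σ-side
    σE = proj₁ (proj₂ σ-side)
    σ-end = proj₂ (proj₂ σ-side)

    alone : ∀ {d} → u ⟶ d → ∃ (Common s d) → d ≡ s
    alone {d} ud o = sym (decidable-stable (s ≟ d) λ s≢d → sideChild-isolated D cu us sx ud s≢d o)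

    groups′ : ∀ {k} → Dec (k ≡ s) → u ⟶ k → Rlz (Group u k)
    groups′ (yes eq) uk = restrict
      (λ (d , ud , o , di) → subst (λ d → L d _) (alone ud (subst (λ k → ∃ (Common k d)) eq o)) di) σ
    groups′ (no _)   uk = group ih uk

    groups′-f₁ : ∀ (d : Dec (s ≡ s)) us → f₁ (groups′ d us) ≡ f₁ σ
    groups′-f₁ (yes _)  _ = refl
    groups′-f₁ (no s≢s) _ = contradiction refl s≢s

    groups′-f₂ : ∀ (d : Dec (s ≡ s)) us → f₂ (groups′ d us) ≡ f₂ σ
    groups′-f₂ (yes _)  _ = refl
    groups′-f₂ (no s≢s) _ = contradiction refl s≢s

    open Node {u} (inner us) (λ {k} → groups′ (k ≟ s)) (numbering end s) (numbering-injective end s)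

    rep-s : rep s ≡ s
    rep-s = let ur , y , ry , sy = rep-linked us in alone ur (y , sy , ry)

    cl-s : ∀ {i} → L s i → cl i ≡ s
    cl-s si = trans (cl≡rep us si) rep-s

    class-s : ∀ {i} → L u i → cl i ≡ s → L s i
    class-s ui eq with classInGroup (ui , eq)
    ... | _ , d , ud , o , di = subst (λ d → L d _) (alone ud o) di

    σ₁ : Preserves (L s) (f₁ σ) (f₁ realizer)
    σ₁ si sj = group-preserved₁ us (groups′-f₁ (s ≟ s)) (step us si , cl-s si) (step us sj , cl-s sj)

    σ₂ : Preserves (L s) (f₂ σ) (f₂ realizer)
    σ₂ si sj = group-preserved₂ us (groups′-f₂ (s ≟ s)) (step us si , cl-s si) (step us sj , cl-s sj)

    extends : Extends realizer E
    extends = record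
      { ext₁ = λ xi xj lt → σ₁ (sx ++ xi) (sx ++ xj) (ext₁ σE xi xj lt)
      ; ext₂ = λ xi xj lt → σ₂ (sx ++ xi) (sx ++ xj) (ext₂ σE xi xj lt)
      }

    atEnd : AtEnd end (f₁ realizer) (L u) (L x)
    atEnd {i} {j} ui ¬xi xj with cl i ≟ s
    ... | yes eq = beyond-map end (σ₁ si sj) (σ₁ sj si) (σ-end si ¬xi xj)
      where
      si = class-s ui eq
      sj = sx ++ xj
    -- A leaf of another group is compared through the block numbers.
    ... | no cl≢s = beyond-map end across across
      (subst (λ k → Beyond end (numbering end s (cl i)) (numbering end s k)) (sym (cl-s (sx ++ xj)))
        (numbering-beyond end cl≢s))

  allRealized : ∀ u → Acc _≺_ u → Realized u
  allRealized u (acc rs) = realized (realizeWhole u ih) (realizeSide u ih)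
    where
    ih : ∀ {w} → w ≺ u → Realized w
    ih w≺u = allRealized _ (rs w≺u)

  permutationGraph : IsPermutationGraph G
  permutationGraph = realizer⇒permutationGraph G (λ i → rooted (φ i))
    (whole (allRealized root (≺-wellFounded root)))

-- From the axioms of a galled-tree to the hypotheses of the construction

root-reaches : ∀ {m} {A : Arcs m} (acyclic : Acyclic A) r → (∀ v → indeg A v ≡ 0 → v ≡ r) → ∀ v → Path A r v
root-reaches {A = A} acyclic r unique v = go v (≻-wellFounded v)
  where
  open Dag A acyclic
  go : ∀ v → Acc (flip _≺_) v → Path A r v
  go v (acc rs) with any? (_⟶? v)
  ... | yes (u , e) = go u (rs (v , e , here)) ++ arc e
  -- A vertex without parents has indegree 0 and is therefore the root.
  ... | no none with refl ← unique v (countTrue-none _ λ u → Boolₚ.¬-not λ e → none (u , e)) = here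

mainTheorem10 : ∀ (n : ℕ) (G : Graph n) → IsGaTEx G → IsPermutationGraph G
mainTheorem10 n G (m , A , t , φ , φ-inj , inj₁ (refl , _ , _) , _ , _) =
  -- In the one-vertex network, injectivity of `φ` leaves at most one vertex in `G`.
  realizer⇒permutationGraph G {S = λ _ → ⊤} _
    (Realizers.subsingleton (Adj G) (Graph.sym G) λ _ _ → φ-inj _ _ (fin1 _ _))
  where
  fin1 : (i j : Fin 1) → i ≡ j
  fin1 Fin.zero Fin.zero = refl
mainTheorem10 n G (m , A , t , φ , φ-inj
                  , inj₂ (acyclic , _ , (r , indeg-r , _ , unique , inner) , leaves , galled) , _ , explains) =
  Explained.permutationGraph G A acyclic hybrid-indeg galled r (root-reaches acyclic r unique)
    t φ φ-inj leaf explains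
  where
  leaf : ∀ {i c} → A (φ i) c ≢ true
  leaf {i} e with Equivalence.to (leaves (φ i)) (i , refl)
  ... | out , _ = contradiction (subst (1 ≤_) out (countTrue≥1 (A (φ i)) e)) λ ()

  -- Two distinct parents exclude the root, the leaves and the vertices of indegree 1, which leaves
  -- only hybrid-vertices.
  hybrid-indeg : ∀ {x p q} → A p x ≡ true → A q x ≡ true → p ≢ q → indeg A x ≡ 2
  hybrid-indeg {x} px qx p≢q with countTrue≥2 (λ u → A u x) px qx p≢q | x ≟ r | any? (λ i → φ i ≟ x)
  ... | two | yes refl | _ = contradiction (subst (2 ≤_) indeg-r two) λ ()
  ... | two | no _ | yes X with Equivalence.to (leaves x) X
  ...   | _ , in1 = contradiction (subst (2 ≤_) in1 two) λ { (s≤s ()) }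
  hybrid-indeg {x} px qx p≢q | two | no x≢r | no ¬X with inner x x≢r ¬X
  ...   | inj₁ (in1 , _) = contradiction (subst (2 ≤_) in1 two) λ { (s≤s ()) }
  ...   | inj₂ (in2 , _) = in2
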